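{- Let $P \subseteq \mathbb{R}^2$ be a nonempty open set, and let $Q_P = P \cap \mathbb{Q}^2$ be the set of points of $P$ with both coordinates rational. Then $\operatorname{opx}(n, Q_P) = \Theta(n^2)$ (as $n \to \infty$ over positive reals), where the constant in the lower bound depends on $P$.
   Context: Containment for subsets of the plane: for $P, S \subseteq \mathbb{R}^2$, let $X_P, Y_P$ be the sets of $x$-coordinates and $y$-coordinates of points of $P$, and $X_S, Y_S$ likewise for $S$. $S$ contains $P$ if there exist functions $f_X: X_P \to X_S$ and $f_Y: Y_P \to Y_S$ such that (1) $\frac{f_X(x_0)-f_X(x_1)}{x_0-x_1} \ge 1$ for all $x_0 > x_1$ in $X_P$; (2) $\frac{f_Y(y_0)-f_Y(y_1)}{y_0-y_1} \ge 1$ for all $y_0 > y_1$ in $Y_P$; (3) $(f_X(x), f_Y(y)) \in S$ for all $(x,y) \in P$. Otherwise $S$ is $P$-free. For real $n > 0$, $\operatorname{opx}(n,P)$ is the supremum of the Lebesgue measure $\mu_2(S)$ over all open (in $\mathbb{R}^2$) $P$-free subsets $S \subseteq [0,n]^2$. $f(n) = \Theta(g(n))$ means there are constants $C_1, C_2 > 0$ with $C_1 g(n) \le f(n) \le C_2 g(n)$ for all sufficiently large $n$. -}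

module Defs where

open import Algebra.Bundles using (CommutativeRing)
import Algebra.Definitions.RawMonoid as RawMonoidDefinitions
open import Data.Fin.Base using (Fin; toℕ)
open import Data.Integer.Base using (ℤ; +_; -[1+_])
open import Data.Nat.Base using (ℕ; suc)
open import Data.Product.Base using (_×_; _,_; ∃; proj₁; proj₂)
open import Data.Rational.Base using (ℚ; ↥_; ↧ₙ_)
open import Function.Bundles using (Func)
open import Level using (Level; 0ℓ)
open import Relation.Binary.Bundles using (Setoid)
open import Relation.Binary.Core using (Rel)
open import Relation.Binary.Structures using (IsTotalOrder)
import Relation.Binary.Construct.NonStrictToStrict as Strict
import Relation.Binary.Construct.On as On
open import Relation.Nullary.Negation using (¬_)
open import Relation.Unary using (Pred; _∈_; _⊆_)

module Bounds {A : Set} (_≤_ : Rel A 0ℓ) where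

  IsUpperBound : ∀ {ℓ} → Pred A ℓ → A → Set ℓ
  IsUpperBound S b = ∀ x → x ∈ S → x ≤ b

  IsLowerBound : ∀ {ℓ} → Pred A ℓ → A → Set ℓ
  IsLowerBound S b = ∀ x → x ∈ S → b ≤ x

  IsSupremum : ∀ {ℓ} → Pred A ℓ → A → Set ℓ
  IsSupremum S s = IsUpperBound S s × (∀ b → IsUpperBound S b → s ≤ b)

  IsInfimum : ∀ {ℓ} → Pred A ℓ → A → Set ℓ
  IsInfimum S s = IsLowerBound S s × (∀ b → IsLowerBound S b → b ≤ s)

-- The axioms that determine ℝ up to unique isomorphism.  Equality is the
-- setoid equality _≈_ of the ring.  The inverse is total, with 0# ⁻¹
-- unspecified.  Completeness is asked for predicates in Set₁ because the
-- suprema below are indexed by subsets of the plane.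
record CompleteOrderedField : Set₂ where
  infix  4 _≤_
  infix  9 _⁻¹
  field
    commutativeRing : CommutativeRing 0ℓ 0ℓ

  open CommutativeRing commutativeRing public

  field
    _⁻¹          : Carrier → Carrier
    ⁻¹-cong      : ∀ {x y} → x ≈ y → x ⁻¹ ≈ y ⁻¹
    *-inverseʳ   : ∀ x → x ≉ 0# → x * x ⁻¹ ≈ 1#
    1≉0          : 1# ≉ 0#
    _≤_          : Rel Carrier 0ℓ
    isTotalOrder : IsTotalOrder _≈_ _≤_
    +-monoˡ-≤    : ∀ z {x y} → x ≤ y → x + z ≤ y + z
    *-nonNeg     : ∀ {x y} → 0# ≤ x → 0# ≤ y → 0# ≤ x * y

  open Bounds _≤_ public

  field
    complete : (S : Pred Carrier (Level.suc 0ℓ)) →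
               ∃ (_∈ S) → ∃ (IsUpperBound S) → ∃ (IsSupremum S)

  open Strict _≈_ _≤_ public using (_<_)

module Plane (ℝ : CompleteOrderedField) where
  open CompleteOrderedField ℝ
  open RawMonoidDefinitions +-rawMonoid using (sum) renaming (_×_ to _·_)

  infixl 7 _÷_
  _÷_ : Carrier → Carrier → Carrier
  x ÷ y = x * y ⁻¹

  fromℤ : ℤ → Carrier
  fromℤ (+ n)    = n · 1#
  fromℤ -[1+ n ] = - (suc n · 1#)

  fromℚ : ℚ → Carrier
  fromℚ q = fromℤ (↥ q) ÷ (↧ₙ q · 1#)

  IsRational : Pred Carrier 0ℓ
  IsRational x = ∃ λ q → x ≈ fromℚ q

  Point : Set
  Point = Carrier × Carrier

  Subset : Set₁
  Subset = Pred Point 0ℓ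

  RationalPoints : Subset → Subset
  RationalPoints P p@(x , y) = p ∈ P × IsRational x × IsRational y

  Square : Carrier → Subset
  Square n (x , y) = (0# ≤ x × x ≤ n) × (0# ≤ y × y ≤ n)

  record Box : Set where
    field
      left right bottom top : Carrier
      left≤right : left ≤ right
      bottom≤top : bottom ≤ top

    interior : Subset
    interior (x , y) = (left < x × x < right) × (bottom < y × y < top)

    area : Carrier
    area = (right - left) * (top - bottom)

  open Box using (interior; area)

  -- Openness in the product topology.  Since _<_ respects _≈_, an open
  -- set is automatically closed under coordinatewise _≈_.
  Open : Pred Subset 0ℓ
  Open S = ∀ p → p ∈ S → ∃ λ B → p ∈ interior B × interior B ⊆ S

  Xs : Subset → Pred Carrier 0ℓ
  Xs S x = ∃ λ y → (x , y) ∈ S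

  Ys : Subset → Pred Carrier 0ℓ
  Ys S y = ∃ λ x → (x , y) ∈ S

  -- Elements of A are compared by their underlying reals only, so a Func
  -- out of this setoid cannot depend on the proof of membership.
  ⟦_⟧ : Pred Carrier 0ℓ → Setoid 0ℓ 0ℓ
  ⟦ A ⟧ = On.setoid {B = ∃ A} setoid proj₁

  SlopesAtLeast1 : {A B : Pred Carrier 0ℓ} → Func ⟦ A ⟧ ⟦ B ⟧ → Set
  SlopesAtLeast1 {A} f = ∀ (s t : ∃ A) → proj₁ t < proj₁ s →
    1# ≤ (proj₁ (to s) - proj₁ (to t)) ÷ (proj₁ s - proj₁ t)
    where open Func f using (to)

  record _Contains_ (S P : Subset) : Set where
    field
      fX      : Func ⟦ Xs P ⟧ ⟦ Xs S ⟧
      fY      : Func ⟦ Ys P ⟧ ⟦ Ys S ⟧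
      slopesX : SlopesAtLeast1 fX
      slopesY : SlopesAtLeast1 fY
      maps    : ∀ x y (p : (x , y) ∈ P) →
                ( proj₁ (Func.to fX (x , y , p))
                , proj₁ (Func.to fY (y , x , p)) ) ∈ S

  _IsFreeOf_ : Subset → Subset → Set
  S IsFreeOf P = ¬ (S Contains P)

  Covers : (ℕ → Box) → Pred Subset 0ℓ
  Covers B S = ∀ p → p ∈ S → ∃ λ k → p ∈ interior (B k)

  -- The areas are nonnegative, so the series converges to c exactly when
  -- c is the supremum of its partial sums.
  TotalArea : (ℕ → Box) → Pred Carrier 0ℓ
  TotalArea B = IsSupremum λ a →
    ∃ λ k → a ≈ sum (λ (i : Fin k) → area (B (toℕ i)))

  -- Lebesgue outer measure, when finite.  Lebesgue measure is its
  -- restriction to the measurable sets; here it is only applied to open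
  -- sets, which are measurable.
  LebesgueMeasure : Subset → Pred Carrier 0ℓ
  LebesgueMeasure S = IsInfimum λ c → ∃ λ B → Covers B S × TotalArea B c

  -- Opx n P v says that opx(n, P) exists and equals v.
  Opx : Carrier → Subset → Pred Carrier (Level.suc 0ℓ)
  Opx n P = IsSupremum λ m → ∃ λ (S : Subset) →
    Open S × S IsFreeOf P × S ⊆ Square n × LebesgueMeasure S m

  -- C₁ g(n) ≤ f(n) ≤ C₂ g(n) for all sufficiently large positive n, where
  -- the function f is given by its graph F.
  EventuallyBetween : ∀ {ℓ} (C₁ C₂ : Carrier)
                      (F : Carrier → Pred Carrier ℓ)
                      (g : Carrier → Carrier) → Set ℓ
  EventuallyBetween C₁ C₂ F g = ∃ λ n₀ → ∀ n → 0# < n → n₀ ≤ n →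
    ∃ λ v → F n v × C₁ * g n ≤ v × v ≤ C₂ * g n

module Submission where

-- Lower bound: cut [0 , n] into m rows of width h = n / m and let the i-th
-- row consist of the points whose i-th binary digit of y / n is 1; this open
-- set S has measure n² / 2.  If S contained the rational points of a box,
-- then abscissae more than h apart would land in distinct rows, so the image
-- of every ordinate would have many prescribed digits.  That leaves so few
-- dyadic cells of length n / 2ᵐ that two ordinates more than this far apart
-- share one, which an expansion does not allow.  Instead of the measure of S
-- it is enough to bound below the areas of a cover of S by boxes; closed
-- rectangles inside S are treated by bisection, and this costs a factor 4.

open import Defs
import Algebra.Construct.NaturalChoice.Max as Max
import Algebra.Construct.NaturalChoice.Min as Min
import Algebra.Properties.AbelianGroup as AbelianGroupProperties
import Algebra.Properties.CommutativeMonoid.Sum as SumProperties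
import Algebra.Properties.Group as GroupProperties
import Algebra.Properties.Ring as RingProperties
import Algebra.Properties.Semiring.Mult as MultProperties
import Algebra.Solver.Ring
open import Algebra.Solver.Ring.AlmostCommutativeRing
  using (fromCommutativeRing; _-Raw-AlmostCommutative⟶_)
open import Axiom.ExcludedMiddle using (ExcludedMiddle)
open import Data.Empty using (⊥; ⊥-elim)
open import Data.Fin.Base as Fin using (Fin; zero; suc; toℕ)
import Data.Fin.Properties as Fin
open import Data.Integer.Base as ℤ using (ℤ; +_; -[1+_])
import Data.Integer.Properties as ℤ
open import Data.Maybe.Base using (Maybe; just; nothing)
open import Data.Nat.Base as ℕ using (ℕ; zero; suc; s≤s; z≤n)
import Data.Nat.GCD as ℕ
import Data.Nat.Properties as ℕ
open import Data.Product.Base using (_×_; _,_; ∃; ∃₂; proj₁; proj₂)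
open import Data.Rational.Base as ℚ using (ℚ; ↥_; ↧ₙ_)
import Data.Rational.Properties as ℚ
open import Data.Sum.Base as Sum using (_⊎_; inj₁; inj₂)
import Data.Sum.Properties as Sum
open import Function.Base using (_∘_)
open import Function.Bundles using (Func)
open import Level using (Level; Lift; lift; 0ℓ)
open import Relation.Binary.Bundles using (TotalOrder)
open import Relation.Binary.PropositionalEquality.Core as ≡ using (_≡_)
import Relation.Binary.Properties.TotalOrder as TotalOrderProperties
import Relation.Binary.Reasoning.PartialOrder as PartialOrderReasoning
import Relation.Binary.Reasoning.Setoid as SetoidReasoning
open import Relation.Binary.Structures using (IsTotalOrder)
open import Relation.Nullary.Decidable.Core using (Dec; yes; no)
open import Relation.Nullary.Negation using (¬_; contradiction)
open import Relation.Unary using (Pred; _∈_; _⊆_; Satisfiable)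

-- It is enough to look at a finite grid of rational points in a box `D` inside `P`. What makes the
-- digits accumulate is that `fX` and `fY` are separate functions: the row that an abscissa lands in
-- cannot depend on the ordinate, so every ordinate faces the same list of prescribed digits. The
-- number of rows is m = ρ², where n < ρ · width and n < ρ · height for the sides of `D`. Then h = n
-- / ρ², so ρ gaps of length h fit into the width, and ρ + 1 abscissae prescribe ρ + 1 of the m
-- digits. At most 2^m / 2^(ρ+1) cells of length n / 2^m remain. Their total length is at most n /
-- 2^(ρ+1), which is less than the height because ρ < 2^(ρ+1), so `D` has room for one ordinate more
-- than there are cells. The digit set has density 1/2 for every m. Hence m may grow with n at no
-- cost in area, and `D` influences ρ but not the constant.

module OrderedField (em : ExcludedMiddle (Level.suc 0ℓ)) (ℝ : CompleteOrderedField) where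
  open CompleteOrderedField ℝ hiding (zero)
  open Plane ℝ
  open MultProperties semiring public
    using (×-homo-+; ×1-homo-*; ×-assoc-*; ×-assocˡ; ×-congʳ) renaming (_×_ to _·_)
  open GroupProperties +-group using () renaming (ε⁻¹≈ε to -0≈0; ⁻¹-involutive to -‿involutive)
  open AbelianGroupProperties +-abelianGroup using () renaming (⁻¹-∙-comm to -‿+-comm)
  open RingProperties ring using (-‿distribˡ-*; -‿distribʳ-*)

  decide : (A : Set) → Dec A
  decide A with em {Lift (Level.suc 0ℓ) A}
  ... | yes (lift a) = yes a
  ... | no ¬a        = no (λ a → ¬a (lift a))

  by-contradiction : {A : Set} → ¬ ¬ A → A
  by-contradiction {A} ¬¬a with decide A
  ... | yes a = a
  ... | no ¬a = contradiction ¬a ¬¬a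

  -- Integer coefficients for the ring solver.

  module _ where
    open SetoidReasoning setoid

    fromℤ-⊖ : ∀ m n → fromℤ (m ℤ.⊖ n) ≈ m · 1# - n · 1#
    fromℤ-⊖ m       zero    = sym (trans (+-congˡ -0≈0) (+-identityʳ _))
    fromℤ-⊖ zero    (suc n) = sym (+-identityˡ _)
    fromℤ-⊖ (suc m) (suc n) = begin
      fromℤ (suc m ℤ.⊖ suc n)                  ≡⟨ ≡.cong fromℤ (ℤ.[1+m]⊖[1+n]≡m⊖n m n) ⟩
      fromℤ (m ℤ.⊖ n)                          ≈⟨ fromℤ-⊖ m n ⟩
      m · 1# - n · 1#                          ≈⟨ +-congʳ (sym (+-identityˡ _)) ⟩
      0# + m · 1# - n · 1#                     ≈⟨ +-congʳ (+-congʳ (sym (-‿inverseʳ 1#))) ⟩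
      1# - 1# + m · 1# - n · 1#                ≈⟨ +-congʳ (+-assoc _ _ _) ⟩
      1# + (- 1# + m · 1#) - n · 1#            ≈⟨ +-congʳ (+-congˡ (+-comm _ _)) ⟩
      1# + (m · 1# - 1#) - n · 1#              ≈⟨ +-congʳ (sym (+-assoc _ _ _)) ⟩
      1# + m · 1# - 1# - n · 1#                ≈⟨ +-assoc _ _ _ ⟩
      1# + m · 1# + (- 1# - n · 1#)            ≈⟨ +-congˡ (-‿+-comm _ _) ⟩
      1# + m · 1# - (1# + n · 1#)              ∎

    fromℤ-neg : ∀ i → fromℤ (ℤ.- i) ≈ - fromℤ i
    fromℤ-neg (+ zero)  = sym -0≈0
    fromℤ-neg (+ suc n) = refl
    fromℤ-neg -[1+ n ]  = sym (-‿involutive _)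

    fromℤ-+ : ∀ i j → fromℤ (i ℤ.+ j) ≈ fromℤ i + fromℤ j
    fromℤ-+ (+ m)    (+ n)    = ×-homo-+ 1# m n
    fromℤ-+ (+ m)    -[1+ n ] = fromℤ-⊖ m (suc n)
    fromℤ-+ -[1+ m ] (+ n)    = trans (fromℤ-⊖ n (suc m)) (+-comm _ _)
    fromℤ-+ -[1+ m ] -[1+ n ] = begin
      - (suc (suc (m ℕ.+ n)) · 1#)       ≡⟨ ≡.cong (λ k → - (suc k · 1#)) (≡.sym (ℕ.+-suc m n)) ⟩
      - ((suc m ℕ.+ suc n) · 1#)         ≈⟨ -‿cong (×-homo-+ 1# (suc m) (suc n)) ⟩
      - (suc m · 1# + suc n · 1#)        ≈⟨ sym (-‿+-comm _ _) ⟩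
      - (suc m · 1#) - suc n · 1#        ∎

    fromℤ-*-+ : ∀ i n → fromℤ (i ℤ.* (+ n)) ≈ fromℤ i * n · 1#
    fromℤ-*-+ (+ m) n = begin
      fromℤ (+ m ℤ.* + n)    ≡⟨ ≡.cong fromℤ (≡.sym (ℤ.pos-* m n)) ⟩
      (m ℕ.* n) · 1#         ≈⟨ ×1-homo-* m n ⟩
      m · 1# * n · 1#        ∎
    fromℤ-*-+ -[1+ m ] n = begin
      fromℤ (-[1+ m ] ℤ.* + n)        ≡⟨ ≡.cong fromℤ (≡.sym (ℤ.neg-distribˡ-* (+ suc m) (+ n))) ⟩
      fromℤ (ℤ.- (+ suc m ℤ.* + n))   ≈⟨ fromℤ-neg (+ suc m ℤ.* + n) ⟩
      - fromℤ (+ suc m ℤ.* + n)       ≈⟨ -‿cong (fromℤ-*-+ (+ suc m) n) ⟩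
      - (suc m · 1# * n · 1#)         ≈⟨ -‿distribˡ-* _ _ ⟩
      - (suc m · 1#) * n · 1#         ∎

    fromℤ-* : ∀ i j → fromℤ (i ℤ.* j) ≈ fromℤ i * fromℤ j
    fromℤ-* i (+ n)    = fromℤ-*-+ i n
    fromℤ-* i -[1+ n ] = begin
      fromℤ (i ℤ.* -[1+ n ])          ≡⟨ ≡.cong fromℤ (≡.sym (ℤ.neg-distribʳ-* i (+ suc n))) ⟩
      fromℤ (ℤ.- (i ℤ.* + suc n))     ≈⟨ fromℤ-neg (i ℤ.* + suc n) ⟩
      - fromℤ (i ℤ.* + suc n)         ≈⟨ -‿cong (fromℤ-*-+ i (suc n)) ⟩
      - (fromℤ i * suc n · 1#)        ≈⟨ -‿distribʳ-* _ _ ⟩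
      fromℤ i * - (suc n · 1#)        ∎

  -- Equality of integers is decidable, which the solver needs to cancel coefficients; equality in
  -- the field has no such test.
  ℤ⟶ℝ : ℤ.+-*-rawRing -Raw-AlmostCommutative⟶ fromCommutativeRing commutativeRing
  ℤ⟶ℝ = record
    { ⟦_⟧    = fromℤ
    ; +-homo = fromℤ-+
    ; *-homo = fromℤ-*
    ; -‿homo = fromℤ-neg
    ; 0-homo = refl
    ; 1-homo = +-identityʳ 1#
    }

  _coeff≟_ : ∀ i j → Maybe (fromℤ i ≈ fromℤ j)
  i coeff≟ j with i ℤ.≟ j
  ... | yes ≡.refl = just refl
  ... | no  _      = nothing

  open Algebra.Solver.Ring ℤ.+-*-rawRing (fromCommutativeRing commutativeRing) ℤ⟶ℝ _coeff≟_ public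
    using (solve; _:=_; _:+_; _:*_; _:-_; :-_; con)


  -- Inequalities in an ordered field.

  totalOrder : TotalOrder 0ℓ 0ℓ 0ℓ
  totalOrder = record { isTotalOrder = isTotalOrder }

  open IsTotalOrder isTotalOrder public
    using (antisym; total)
    renaming (refl to ≤-refl; trans to ≤-trans; reflexive to ≤-reflexive)
  open TotalOrderProperties totalOrder public
    using (≰⇒>; <⇒≱; <-trans; <-respˡ-≈; <-respʳ-≈)
  open Max totalOrder public
    using (_⊔_; ⊔-mono-≤; x≤y⇒x⊔y≈y; x≤x⊔y; x≤y⊔x; ⊔-lub)
  open Min totalOrder public
    using (_⊓_; ⊓-mono-≤; x≤y⇒x⊓y≈x; x⊓y≤x; x⊓y≤y; ⊓-sel)
  module ≤-Reasoning = PartialOrderReasoning (TotalOrder.poset totalOrder)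

  <⇒≤ : ∀ {x y} → x < y → x ≤ y
  <⇒≤ = proj₁

  <-≤-trans : ∀ {x y z} → x < y → y ≤ z → x < z
  <-≤-trans {x} {y} {z} x<y y≤z = begin-strict
    x  <⟨ x<y ⟩
    y  ≤⟨ y≤z ⟩
    z  ∎
    where open ≤-Reasoning

  ≤-<-trans : ∀ {x y z} → x ≤ y → y < z → x < z
  ≤-<-trans {x} {y} {z} x≤y y<z = begin-strict
    x  ≤⟨ x≤y ⟩
    y  <⟨ y<z ⟩
    z  ∎
    where open ≤-Reasoning

  ≮⇒≥ : ∀ {x y} → ¬ (x < y) → y ≤ x
  ≮⇒≥ {x} {y} x≮y = by-contradiction λ y≰x → x≮y (≰⇒> y≰x)

  x≤y⇒0≤y-x : ∀ {x y} → x ≤ y → 0# ≤ y - x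
  x≤y⇒0≤y-x {x} {y} x≤y = begin
    0#     ≈⟨ sym (-‿inverseʳ x) ⟩
    x - x  ≤⟨ +-monoˡ-≤ (- x) x≤y ⟩
    y - x  ∎
    where open ≤-Reasoning

  -- Inequalities are proved by exhibiting y − x as a combination e of
  -- nonnegative terms; the equation is left to the ring solver.
  ≤-by : ∀ {x y} e → 0# ≤ e → e ≈ y - x → x ≤ y
  ≤-by {x} {y} e 0≤e e≈y-x = begin
    x          ≈⟨ sym (+-identityˡ x) ⟩
    0# + x     ≤⟨ +-monoˡ-≤ x 0≤e ⟩
    e + x      ≈⟨ +-congʳ e≈y-x ⟩
    y - x + x  ≈⟨ solve 2 (λ x y → y :- x :+ x := y) refl x y ⟩
    y          ∎
    where open ≤-Reasoning

  x<y⇒0<y-x : ∀ {x y} → x < y → 0# < y - x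
  x<y⇒0<y-x {x} {y} x<y = ≰⇒> λ y-x≤0 → <⇒≱ x<y
    (≤-by (0# - (y - x)) (x≤y⇒0≤y-x y-x≤0)
      (solve 2 (λ x y → con (+ 0) :- (y :- x) := x :- y) refl x y))

  <-by : ∀ {x y} e → 0# < e → e ≈ y - x → x < y
  <-by {x} {y} e 0<e e≈y-x = ≰⇒> λ y≤x → <⇒≱ 0<e
    (≤-by (x - y) (x≤y⇒0≤y-x y≤x)
      (trans (solve 2 (λ x y → x :- y := con (+ 0) :- (y :- x)) refl x y)
             (+-congˡ (-‿cong (sym e≈y-x)))))

  0≤x+y : ∀ {x y} → 0# ≤ x → 0# ≤ y → 0# ≤ x + y
  0≤x+y {x} {y} 0≤x 0≤y = ≤-trans 0≤y (≤-by x 0≤x (solve 2 (λ x y → x := x :+ y :- y) refl x y))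

  0<x+y : ∀ {x y} → 0# < x → 0# ≤ y → 0# < x + y
  0<x+y {x} {y} 0<x 0≤y = ≤-<-trans 0≤y (<-by x 0<x (solve 2 (λ x y → x := x :+ y :- y) refl x y))

  +-mono-≤ : ∀ {x y u v} → x ≤ y → u ≤ v → x + u ≤ y + v
  +-mono-≤ {x} {y} {u} {v} x≤y u≤v = ≤-by ((y - x) + (v - u))
    (0≤x+y (x≤y⇒0≤y-x x≤y) (x≤y⇒0≤y-x u≤v))
    (solve 4 (λ x y u v → (y :- x) :+ (v :- u) := y :+ v :- (x :+ u)) refl x y u v)

  +-monoˡ-< : ∀ z {x y} → x < y → x + z < y + z
  +-monoˡ-< z {x} {y} x<y = <-by (y - x) (x<y⇒0<y-x x<y)
    (solve 3 (λ x y z → y :- x := y :+ z :- (x :+ z)) refl x y z)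

  x≤x+y : ∀ {x y} → 0# ≤ y → x ≤ x + y
  x≤x+y {x} {y} 0≤y = ≤-by y 0≤y (solve 2 (λ x y → y := x :+ y :- x) refl x y)

  x<x+y : ∀ {x y} → 0# < y → x < x + y
  x<x+y {x} {y} 0<y = <-by y 0<y (solve 2 (λ x y → y := x :+ y :- x) refl x y)

  sub-mono-≤ : ∀ {x y u v} → x ≤ y → v ≤ u → x - u ≤ y - v
  sub-mono-≤ {x} {y} {u} {v} x≤y v≤u = ≤-by ((y - x) + (u - v))
    (0≤x+y (x≤y⇒0≤y-x x≤y) (x≤y⇒0≤y-x v≤u))
    (solve 4 (λ x y u v → (y :- x) :+ (u :- v) := (y :- v) :- (x :- u)) refl x y u v)

  -- If 1 ≤ 0, then -1 is nonnegative, and so is its square, which is 1.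
  0≤1 : 0# ≤ 1#
  0≤1 with total 0# 1#
  ... | inj₁ 0≤1 = 0≤1
  ... | inj₂ 1≤0 = ≤-trans (*-nonNeg (x≤y⇒0≤y-x 1≤0) (x≤y⇒0≤y-x 1≤0)) (≤-reflexive
    (trans (solve 1 (λ x → (con (+ 0) :- x) :* (con (+ 0) :- x) := x :* x) refl 1#) (*-identityˡ 1#)))

  0<1 : 0# < 1#
  0<1 = 0≤1 , 1≉0 ∘ sym

  *-pos : ∀ {x y} → 0# < x → 0# < y → 0# < x * y
  *-pos {x} {y} 0<x 0<y = *-nonNeg (<⇒≤ 0<x) (<⇒≤ 0<y) , λ 0≈xy → proj₂ 0<y (begin
    0#               ≈⟨ sym (zeroˡ _) ⟩
    0# * x ⁻¹        ≈⟨ *-congʳ 0≈xy ⟩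
    x * y * x ⁻¹     ≈⟨ solve 3 (λ x y z → x :* y :* z := y :* (x :* z)) refl x y (x ⁻¹) ⟩
    y * (x * x ⁻¹)   ≈⟨ *-congˡ (*-inverseʳ x (proj₂ 0<x ∘ sym)) ⟩
    y * 1#           ≈⟨ *-identityʳ y ⟩
    y                ∎)
    where open SetoidReasoning setoid

  *-monoˡ-≤ : ∀ {x y z} → 0# ≤ z → x ≤ y → z * x ≤ z * y
  *-monoˡ-≤ {x} {y} {z} 0≤z x≤y = ≤-by (z * (y - x)) (*-nonNeg 0≤z (x≤y⇒0≤y-x x≤y))
    (solve 3 (λ x y z → z :* (y :- x) := z :* y :- z :* x) refl x y z)

  *-monoˡ-< : ∀ {x y z} → 0# < z → x < y → z * x < z * y
  *-monoˡ-< {x} {y} {z} 0<z x<y = <-by (z * (y - x)) (*-pos 0<z (x<y⇒0<y-x x<y))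
    (solve 3 (λ x y z → z :* (y :- x) := z :* y :- z :* x) refl x y z)

  *-mono-≤ : ∀ {x y u v} → 0# ≤ x → 0# ≤ v → x ≤ y → u ≤ v → x * u ≤ y * v
  *-mono-≤ {x} {y} {u} {v} 0≤x 0≤v x≤y u≤v = begin
    x * u  ≤⟨ *-monoˡ-≤ 0≤x u≤v ⟩
    x * v  ≈⟨ *-comm x v ⟩
    v * x  ≤⟨ *-monoˡ-≤ 0≤v x≤y ⟩
    v * y  ≈⟨ *-comm v y ⟩
    y * v  ∎
    where open ≤-Reasoning

  *-cancelˡ-< : ∀ {x y z} → 0# ≤ z → z * x < z * y → x < y
  *-cancelˡ-< 0≤z zx<zy = ≰⇒> λ y≤x → <⇒≱ zx<zy (*-monoˡ-≤ 0≤z y≤x)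

  *-inverse : ∀ {x} → 0# < x → x * x ⁻¹ ≈ 1#
  *-inverse 0<x = *-inverseʳ _ (proj₂ 0<x ∘ sym)

  x*[y÷x]≈y : ∀ {x} y → 0# < x → x * (y ÷ x) ≈ y
  x*[y÷x]≈y {x} y 0<x = begin
    x * (y * x ⁻¹)  ≈⟨ solve 3 (λ x y z → x :* (y :* z) := x :* z :* y) refl x y (x ⁻¹) ⟩
    x * x ⁻¹ * y    ≈⟨ *-congʳ (*-inverse 0<x) ⟩
    1# * y          ≈⟨ *-identityˡ y ⟩
    y               ∎
    where open SetoidReasoning setoid

  ÷-pos : ∀ {x y} → 0# < x → 0# < y → 0# < y ÷ x
  ÷-pos {x} {y} 0<x 0<y = *-cancelˡ-< (<⇒≤ 0<x)
    (<-respˡ-≈ (sym (zeroʳ x)) (<-respʳ-≈ (sym (x*[y÷x]≈y y 0<x)) 0<y))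

  1≤x÷y⇒y≤x : ∀ {x y} → 0# < y → 1# ≤ x ÷ y → y ≤ x
  1≤x÷y⇒y≤x {x} {y} 0<y 1≤x÷y = begin
    y            ≈⟨ sym (*-identityʳ y) ⟩
    y * 1#       ≤⟨ *-monoˡ-≤ (<⇒≤ 0<y) 1≤x÷y ⟩
    y * (x ÷ y)  ≈⟨ x*[y÷x]≈y x 0<y ⟩
    x            ∎
    where open ≤-Reasoning

  z<x⊓y : ∀ {x y z} → z < x → z < y → z < x ⊓ y
  z<x⊓y {x} {y} z<x z<y with ⊓-sel x y
  ... | inj₁ eq = <-respʳ-≈ (sym eq) z<x
  ... | inj₂ eq = <-respʳ-≈ (sym eq) z<y

  ·-nonNeg : ∀ k {x} → 0# ≤ x → 0# ≤ k · x
  ·-nonNeg zero    0≤x = ≤-refl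
  ·-nonNeg (suc k) 0≤x = 0≤x+y 0≤x (·-nonNeg k 0≤x)

  ·-pos : ∀ k {x} → 0# < x → 0# < suc k · x
  ·-pos k 0<x = 0<x+y 0<x (·-nonNeg k (<⇒≤ 0<x))

  ·-monoˡ-≤ : ∀ {j k x} → 0# ≤ x → j ℕ.≤ k → j · x ≤ k · x
  ·-monoˡ-≤ {k = k} 0≤x z≤n       = ·-nonNeg k 0≤x
  ·-monoˡ-≤         0≤x (s≤s j≤k) = +-mono-≤ ≤-refl (·-monoˡ-≤ 0≤x j≤k)

  ·-monoʳ-≤ : ∀ k {x y} → x ≤ y → k · x ≤ k · y
  ·-monoʳ-≤ zero    x≤y = ≤-refl
  ·-monoʳ-≤ (suc k) x≤y = +-mono-≤ x≤y (·-monoʳ-≤ k x≤y)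

  ·-cancelʳ-< : ∀ k {x y} → k · x < k · y → x < y
  ·-cancelʳ-< k kx<ky = ≰⇒> λ y≤x → <⇒≱ kx<ky (·-monoʳ-≤ k y≤x)

  ·-cancelˡ-< : ∀ {j k x} → 0# ≤ x → j · x < k · x → j ℕ.< k
  ·-cancelˡ-< 0≤x jx<kx = ℕ.≰⇒> λ k≤j → <⇒≱ jx<kx (·-monoˡ-≤ 0≤x k≤j)

  k·x≈[k·1]*x : ∀ k x → k · x ≈ k · 1# * x
  k·x≈[k·1]*x k x = sym (trans (×-assoc-* k 1# x) (×-congʳ k (*-identityˡ x)))

  -- Repeated halving.

  half : Carrier → Carrier
  half x = x ÷ (1# + 1#)

  0<2 : 0# < 1# + 1#
  0<2 = 0<x+y 0<1 0≤1

  half+half : ∀ x → half x + half x ≈ x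
  half+half x = begin
    x * h + x * h        ≈⟨ +-cong (sym (*-identityˡ _)) (sym (*-identityˡ _)) ⟩
    1# * (x * h) + 1# * (x * h)
                         ≈⟨ sym (distribʳ _ 1# 1#) ⟩
    (1# + 1#) * (x * h)  ≈⟨ x*[y÷x]≈y x 0<2 ⟩
    x                    ∎
    where
    open SetoidReasoning setoid
    h = (1# + 1#) ⁻¹

  half-pos : ∀ {x} → 0# < x → 0# < half x
  half-pos = ÷-pos 0<2

  -- This is x / 2^k. The argument is halved before the recursive call, so that `halves (suc m) W`
  -- computes to `halves m (half W)`, the form met when an interval is split and the digits are
  -- shifted.
  halves : ℕ → Carrier → Carrier
  halves zero    x = x
  halves (suc k) x = halves k (half x)

  halves-pos : ∀ k {x} → 0# < x → 0# < halves k x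
  halves-pos zero    0<x = 0<x
  halves-pos (suc k) 0<x = halves-pos k (half-pos 0<x)

  2^k·halves : ∀ k x → (2 ℕ.^ k) · halves k x ≈ x
  2^k·halves zero    x = +-identityʳ x
  2^k·halves (suc k) x = begin
    (2 ℕ.^ suc k) · y                      ≈⟨ ×-homo-+ y (2 ℕ.^ k) (2 ℕ.^ k ℕ.+ 0) ⟩
    (2 ℕ.^ k) · y + (2 ℕ.^ k ℕ.+ 0) · y    ≡⟨ ≡.cong (λ j → (2 ℕ.^ k) · y + j · y) (ℕ.+-identityʳ (2 ℕ.^ k)) ⟩
    (2 ℕ.^ k) · y + (2 ℕ.^ k) · y          ≈⟨ +-cong (2^k·halves k (half x)) (2^k·halves k (half x)) ⟩
    half x + half x                        ≈⟨ half+half x ⟩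
    x                                      ∎
    where
    open SetoidReasoning setoid
    y = halves k (half x)

  half-mono-≤ : ∀ {x y} → x ≤ y → half x ≤ half y
  half-mono-≤ {x} {y} x≤y = ≮⇒≥ λ y<x → <⇒≱ (begin-strict
    y                ≈⟨ sym (half+half y) ⟩
    half y + half y  <⟨ +-monoˡ-< (half y) y<x ⟩
    half x + half y  ≤⟨ +-mono-≤ ≤-refl (<⇒≤ y<x) ⟩
    half x + half x  ≈⟨ half+half x ⟩
    x                ∎) x≤y
    where open ≤-Reasoning

  halves-mono-≤ : ∀ k {x y} → x ≤ y → halves k x ≤ halves k y
  halves-mono-≤ zero    x≤y = x≤y
  halves-mono-≤ (suc k) x≤y = halves-mono-≤ k (half-mono-≤ x≤y)

  halves-half : ∀ k x → halves k (half x) ≡ half (halves k x)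
  halves-half zero    x = ≡.refl
  halves-half (suc k) x = halves-half k (half x)

  half<x : ∀ {x} → 0# < x → half x < x
  half<x {x} 0<x = <-respʳ-≈ (half+half x) (x<x+y (half-pos 0<x))

  n<2^n : ∀ n → n ℕ.< 2 ℕ.^ n
  n<2^n zero    = s≤s z≤n
  n<2^n (suc n) = ℕ.+-mono-≤ (ℕ.≤-trans (s≤s z≤n) (n<2^n n)) (ℕ.m≤n⇒m≤n+o 0 (n<2^n n))

  -- Consequences of completeness.

  supremum : (A : Pred Carrier 0ℓ) → Satisfiable A → ∃ (IsUpperBound A) → ∃ (IsSupremum A)
  supremum A (a , a∈A) (b , A≤b) =
    let s , s-ub , s-lub = complete (λ x → Lift _ (A x)) (a , lift a∈A) (b , λ { x (lift x∈A) → A≤b x x∈A })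
    in s , (λ x x∈A → s-ub x (lift x∈A)) , λ c A≤c → s-lub c (λ { x (lift x∈A) → A≤c x x∈A })

  infimum : (A : Pred Carrier 0ℓ) → Satisfiable A → ∃ (IsLowerBound A) → ∃ (IsInfimum A)
  infimum A (a , a∈A) (b , b≤A) =
    let s , s-ub , s-lub = supremum (IsLowerBound A) (b , b≤A) (a , λ x x≤A → x≤A a a∈A)
    in s , (λ x x∈A → s-lub x (λ y y≤A → y≤A x x∈A)) , s-ub

  -- Otherwise the multiples of 1 have a supremum s; as k + 1 ≤ s for every k, also s - 1 is an
  -- upper bound, which is absurd.
  archimedean : ∀ x → ∃ λ k → x < k · 1#
  archimedean x = by-contradiction λ ¬∃ →
    let bounded : IsUpperBound (λ y → ∃ λ k → y ≈ k · 1#) x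
        bounded = λ { y (k , y≈k) → ≤-trans (≤-reflexive y≈k) (≮⇒≥ λ x<k → ¬∃ (k , x<k)) }
        s , s-ub , s-lub = supremum _ (0# , 0 , refl) (x , bounded)
        s≤s-1 = s-lub (s - 1#) λ { y (k , y≈k) → ≤-by (s - (1# + k · 1#))
          (x≤y⇒0≤y-x (s-ub _ (suc k , refl)))
          (trans (solve 3 (λ s o k → s :- (o :+ k) := s :- o :- k) refl s 1# (k · 1#))
                 (+-congˡ (-‿cong (sym y≈k)))) }
    in <⇒≱ (<-by 1# 0<1 (solve 2 (λ s o → o := s :- (s :- o)) refl s 1#)) s≤s-1

  archimedean-· : ∀ {y} x → 0# < y → ∃ λ k → x < k · y
  archimedean-· {y} x 0<y = let k , x÷y<k = archimedean (x ÷ y) in k , (begin-strict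
    x            ≈⟨ sym (x*[y÷x]≈y x 0<y) ⟩
    y * (x ÷ y)  <⟨ *-monoˡ-< 0<y x÷y<k ⟩
    y * k · 1#   ≈⟨ *-comm y _ ⟩
    k · 1# * y   ≈⟨ sym (k·x≈[k·1]*x k y) ⟩
    k · y        ∎)
    where open ≤-Reasoning

  -- Some k has x < k · ε, and dividing by 2^k > k then brings x below ε.
  halves-small : ∀ {ε x} → 0# < ε → 0# < x → ∃ λ k → halves k x < ε
  halves-small {ε} {x} 0<ε 0<x = let k , x<kε = archimedean-· x 0<ε in k , ≰⇒> λ ε≤h → <⇒≱ x<kε (begin
    k · ε                    ≈⟨ k·x≈[k·1]*x k ε ⟩
    k · 1# * ε               ≤⟨ *-mono-≤ (·-nonNeg k 0≤1) (<⇒≤ (halves-pos k 0<x))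
                                  (·-monoˡ-≤ 0≤1 (ℕ.<⇒≤ (n<2^n k))) ε≤h ⟩
    (2 ℕ.^ k) · 1# * halves k x  ≈⟨ sym (k·x≈[k·1]*x (2 ℕ.^ k) _) ⟩
    (2 ℕ.^ k) · halves k x   ≈⟨ 2^k·halves k x ⟩
    x                        ∎)
    where open ≤-Reasoning

  -- The supremum of the left ends works: any `l j` is compared with any `r k` through the interval
  -- of index j + k.
  nested-intervals : (l r : ℕ → Carrier) → (∀ k → l k ≤ r k) →
    (∀ k → l k ≤ l (suc k)) → (∀ k → r (suc k) ≤ r k) →
    ∃ λ p → ∀ k → l k ≤ p × p ≤ r k
  nested-intervals l r l≤r l-mono r-anti =
    let s , s-ub , s-lub = supremum (λ y → ∃ λ k → y ≈ l k) (l 0 , 0 , refl) (r 0 , below 0)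
    in s , λ k → s-ub (l k) (k , refl) , s-lub (r k) (below k)
    where
    mono : ∀ j k → l j ≤ l (k ℕ.+ j)
    mono j zero    = ≤-refl
    mono j (suc k) = ≤-trans (mono j k) (l-mono _)
    anti : ∀ j k → r (k ℕ.+ j) ≤ r j
    anti j zero    = ≤-refl
    anti j (suc k) = ≤-trans (r-anti _) (anti j k)
    below : ∀ k → IsUpperBound (λ y → ∃ λ j → y ≈ l j) (r k)
    below k y (j , y≈lj) = begin
      y            ≈⟨ y≈lj ⟩
      l j          ≤⟨ mono j k ⟩
      l (k ℕ.+ j)  ≤⟨ l≤r (k ℕ.+ j) ⟩
      r (k ℕ.+ j)  ≡⟨ ≡.cong r (ℕ.+-comm k j) ⟩
      r (j ℕ.+ k)  ≤⟨ anti k j ⟩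
      r k          ∎
      where open ≤-Reasoning

-- Rational points of intervals.

module RationalPointsOfIntervals (em : ExcludedMiddle (Level.suc 0ℓ)) (ℝ : CompleteOrderedField) where
  open CompleteOrderedField ℝ hiding (zero)
  open Plane ℝ
  open OrderedField em ℝ

  -- The library reduces `i / suc n` to lowest terms, so both numerator and denominator have lost
  -- the factor gcd, which must be put back.
  fraction-isRational : ∀ i n → IsRational (fromℤ i ÷ suc n · 1#)
  fraction-isRational i n = q , (begin
    fromℤ i * D ⁻¹              ≡⟨ ≡.cong (λ j → fromℤ j * D ⁻¹) (≡.sym (ℚ.↥-/ i (suc n))) ⟩
    fromℤ (↥ q ℤ.* (+ g)) * D ⁻¹
                                ≈⟨ *-congʳ (fromℤ-* (↥ q) (+ g)) ⟩
    a * G * D ⁻¹                ≈⟨ *-congʳ (sym (*-identityˡ _)) ⟩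
    1# * (a * G) * D ⁻¹         ≈⟨ *-congʳ (*-congʳ (sym (*-inverse (·-pos (ℚ.denominator-1 q) 0<1)))) ⟩
    b * b ⁻¹ * (a * G) * D ⁻¹   ≈⟨ solve 5 (λ a G D b c → b :* c :* (a :* G) :* D := a :* c :* (b :* G :* D))
                                     refl a G (D ⁻¹) b (b ⁻¹) ⟩
    a * b ⁻¹ * (b * G * D ⁻¹)   ≈⟨ *-congˡ (*-congʳ b*G≈D) ⟩
    a * b ⁻¹ * (D * D ⁻¹)       ≈⟨ *-congˡ (*-inverse (·-pos n 0<1)) ⟩
    a * b ⁻¹ * 1#               ≈⟨ *-identityʳ _ ⟩
    a * b ⁻¹                    ∎)
    where
    open SetoidReasoning setoid
    q = i ℚ./ suc n
    g = ℕ.gcd ℤ.∣ i ∣ (suc n)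
    a = fromℤ (↥ q)
    b = ↧ₙ q · 1#
    D = suc n · 1#
    G = g · 1#
    b*G≈D : b * G ≈ D
    b*G≈D = trans (sym (fromℤ-* (+ ↧ₙ q) (+ g))) (reflexive (≡.cong fromℤ (ℚ.↧-/ i (suc n))))

  -- The search runs downwards from the bound `k` and stops at the first natural whose predecessor
  -- no longer exceeds `t`.
  next-natural : ∀ k {t} → 0# ≤ t → t < k · 1# → ∃ λ j → t < j · 1# × j · 1# ≤ t + 1#
  next-natural zero    0≤t t<0 = contradiction 0≤t (<⇒≱ t<0)
  next-natural (suc k) {t} 0≤t t<1+k with decide (t < k · 1#)
  ... | yes t<k = next-natural k 0≤t t<k
  ... | no  t≮k = suc k , t<1+k , ≤-trans (+-mono-≤ ≤-refl (≮⇒≥ t≮k)) (≤-reflexive (+-comm 1# t))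

  next-integer : ∀ t → ∃ λ i → t < fromℤ i × fromℤ i ≤ t + 1#
  next-integer t = j ℤ.⊖ k ,
    <-respʳ-≈ (sym (fromℤ-⊖ j k))
      (<-by (J - (t + K)) (x<y⇒0<y-x t+K<J)
        (solve 3 (λ J t K → J :- (t :+ K) := J :- K :- t) refl J t K)) ,
    ≤-trans (≤-reflexive (fromℤ-⊖ j k))
      (≤-by (t + K + 1# - J) (x≤y⇒0≤y-x J≤t+K+1)
        (solve 4 (λ J t K o → t :+ K :+ o :- J := t :+ o :- (J :- K)) refl J t K 1#))
    where
    -- Adding a natural above -t makes the argument nonnegative, as `next-natural` requires.
    k,-t<k = archimedean (- t)
    k = proj₁ k,-t<k
    K = k · 1#
    0≤t+K : 0# ≤ t + K
    0≤t+K = ≤-by (K - - t) (x≤y⇒0≤y-x (<⇒≤ (proj₂ k,-t<k)))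
      (solve 2 (λ t K → K :- :- t := t :+ K :- con (+ 0)) refl t K)
    next = let l , t+K<l = archimedean (t + K) in next-natural l 0≤t+K t+K<l
    j = proj₁ next
    J = j · 1#
    t+K<J = proj₁ (proj₂ next)
    J≤t+K+1 = proj₂ (proj₂ next)

  -- For a denominator D with D (y - x) > 1, the first integer above D x is still below D y.
  rational-between : ∀ {x y} → x < y → ∃ λ z → IsRational z × x < z × z < y
  rational-between {x} {y} x<y = let k , 1<k[y-x] = archimedean-· 1# (x<y⇒0<y-x x<y) in by-denominator k 1<k[y-x]
    where
    by-denominator : ∀ k → 1# < k · (y - x) → ∃ λ z → IsRational z × x < z × z < y
    by-denominator zero    1<0       = contradiction 0≤1 (<⇒≱ 1<0)
    by-denominator (suc d) 1<D[y-x] =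
      let i , Dx<i , i≤Dx+1 = next-integer (D * x)
          Dz≈i = x*[y÷x]≈y (fromℤ i) 0<D
      in fromℤ i ÷ D , fraction-isRational i d ,
         *-cancelˡ-< (<⇒≤ 0<D) (<-respʳ-≈ (sym Dz≈i) Dx<i) ,
         *-cancelˡ-< (<⇒≤ 0<D) (begin-strict
           D * (fromℤ i ÷ D)    ≈⟨ Dz≈i ⟩
           fromℤ i              ≤⟨ i≤Dx+1 ⟩
           D * x + 1#           <⟨ <-by (D * (y - x) - 1#) (x<y⇒0<y-x (<-respʳ-≈ (k·x≈[k·1]*x (suc d) _) 1<D[y-x]))
                                     (solve 4 (λ D x y o → D :* (y :- x) :- o := D :* y :- (D :* x :+ o)) refl D x y 1#) ⟩
           D * y                ∎)
      where
      open ≤-Reasoning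
      D = suc d · 1#
      0<D : 0# < D
      0<D = ·-pos d 0<1

  -- The first point is taken so far left that all the later gaps still fit between it and `b`; the
  -- others come from the interval that starts `h` after it.
  separated-rationals : ∀ k {a b h} → 0# ≤ h → k · h < b - a →
    ∃ λ (x : Fin (suc k) → Carrier) →
      (∀ i → IsRational (x i) × a < x i × x i < b) ×
      (∀ {i j} → i Fin.< j → x i + h < x j)
  separated-rationals zero {a} {b} 0≤h 0<b-a =
    let z , z∈ℚ , a<z , z<b = rational-between
          (<-by (b - a - 0#) (x<y⇒0<y-x 0<b-a) (solve 2 (λ a b → b :- a :- con (+ 0) := b :- a) refl a b))
    in (λ _ → z) , (λ _ → z∈ℚ , a<z , z<b) , λ { {zero} {zero} () }
  separated-rationals (suc k) {a} {b} {h} 0≤h [1+k]h<b-a =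
    let z , z∈ℚ , a<z , z<c = rational-between
          (<-by (b - a - (h + k · h)) (x<y⇒0<y-x [1+k]h<b-a)
            (solve 4 (λ a b h H → b :- a :- (h :+ H) := b :- (h :+ H) :- a) refl a b h (k · h)))
        x , x-prop , x-sep = separated-rationals k 0≤h
          (<-by (b - (h + k · h) - z) (x<y⇒0<y-x z<c)
            (solve 4 (λ z b h H → b :- (h :+ H) :- z := b :- (z :+ h) :- H) refl z b h (k · h)))
        z<b = <-≤-trans z<c (≤-by (h + k · h) (·-nonNeg (suc k) 0≤h)
                (solve 2 (λ b H → H := b :- (b :- H)) refl b (h + k · h)))
    in (λ { zero → z ; (suc i) → x i }) ,
       (λ { zero    → z∈ℚ , a<z , z<b
          ; (suc i) → let xᵢ∈ℚ , z+h<xᵢ , xᵢ<b = x-prop i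
                      in xᵢ∈ℚ , <-trans a<z (≤-<-trans (x≤x+y 0≤h) z+h<xᵢ) , xᵢ<b }) ,
       λ { {zero}  {zero}  ()
         ; {zero}  {suc j} _         → proj₁ (proj₂ (x-prop j))
         ; {suc i} {suc j} (s≤s i<j) → x-sep i<j }

-- Binary digits and the count of dyadic cells.

module Digits (em : ExcludedMiddle (Level.suc 0ℓ)) (ℝ : CompleteOrderedField) where
  open CompleteOrderedField ℝ hiding (zero)
  open OrderedField em ℝ

  -- Digit i u W consists of the points of the interval (u , u + W) whose
  -- i-th binary digit relative to that interval is 1, except dyadic ones.
  Digit : ℕ → Carrier → Carrier → Pred Carrier 0ℓ
  Digit zero    u W y = u + half W < y × y < u + W
  Digit (suc i) u W y = Digit i u (half W) y ⊎ Digit i (u + half W) (half W) y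

  upper-end : ∀ u W → u + half W + half W ≈ u + W
  upper-end u W = trans (+-assoc u _ _) (+-congˡ (half+half W))

  half-end : ∀ {u W} → 0# < W → u + half W < u + W
  half-end {u} {W} 0<W = <-respʳ-≈ (upper-end u W) (x<x+y (half-pos 0<W))

  Digit-bounds : ∀ i {u W y} → 0# < W → Digit i u W y → u < y × y < u + W
  Digit-bounds zero    0<W (m<y , y<r) = <-trans (x<x+y (half-pos 0<W)) m<y , y<r
  Digit-bounds (suc i) 0<W (inj₁ y∈lower) =
    let u<y , y<m = Digit-bounds i (half-pos 0<W) y∈lower in u<y , <-trans y<m (half-end 0<W)
  Digit-bounds (suc i) {u} {W} 0<W (inj₂ y∈upper) =
    let m<y , y<r = Digit-bounds i (half-pos 0<W) y∈upper
    in <-trans (x<x+y (half-pos 0<W)) m<y , <-respʳ-≈ (upper-end u W) y<r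

  Digit-open : ∀ i {u W y} → Digit i u W y →
    ∃₂ λ a b → (a < y × y < b) × (∀ z → a < z → z < b → Digit i u W z)
  Digit-open zero    y∈       = _ , _ , y∈ , λ _ → _,_
  Digit-open (suc i) (inj₁ y∈) =
    let a , b , a<y<b , inside = Digit-open i y∈ in a , b , a<y<b , λ z a<z z<b → inj₁ (inside z a<z z<b)
  Digit-open (suc i) (inj₂ y∈) =
    let a , b , a<y<b , inside = Digit-open i y∈ in a , b , a<y<b , λ z a<z z<b → inj₂ (inside z a<z z<b)

  -- A partition of `E` into at most N classes of diameter at most w, in a form ready for the
  -- pigeonhole principle. The one-sided bound suffices since `s` and `t` may be exchanged.
  Capacity : Pred Carrier 0ℓ → Carrier → ℕ → Set
  Capacity E w N = ∃ λ (code : ∃ E → Fin N) → ∀ s t → code s ≡ code t → proj₁ t ≤ proj₁ s + w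

  capacity-⊆ : ∀ {E F w N} → E ⊆ F → Capacity F w N → Capacity E w N
  capacity-⊆ E⊆F (code , close) =
    (λ { (y , y∈E) → code (y , E⊆F y∈E) }) , λ { (y , y∈E) (z , z∈E) → close (y , E⊆F y∈E) (z , E⊆F z∈E) }

  -- The codes of `F` and `G` occupy disjoint blocks, so equal codes come from the same set.
  capacity-∪ : ∀ {E F G w M N} → (∀ {y} → E y → F y ⊎ G y) →
    Capacity F w M → Capacity G w N → Capacity E w (M ℕ.+ N)
  capacity-∪ {E} {F} {G} {w} {M} {N} split (codeF , closeF) (codeG , closeG) =
    (λ { (y , y∈E) → Fin.join M N (code (split y∈E)) }) ,
    λ { (y , y∈E) (z , z∈E) eq → close (split y∈E) (split z∈E) (join-injective eq) }
    where
    code : ∀ {y} → F y ⊎ G y → Fin M ⊎ Fin N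
    code = Sum.map (λ y∈F → codeF (_ , y∈F)) (λ y∈G → codeG (_ , y∈G))
    join-injective : ∀ {i j} → Fin.join M N i ≡ Fin.join M N j → i ≡ j
    join-injective {i} {j} eq = ≡.trans (≡.sym (Fin.splitAt-join M N i))
      (≡.trans (≡.cong (Fin.splitAt M) eq) (Fin.splitAt-join M N j))
    close : ∀ {y z} (p : F y ⊎ G y) (q : F z ⊎ G z) → code p ≡ code q → z ≤ y + w
    close (inj₁ p) (inj₁ q) eq = closeF (_ , p) (_ , q) (Sum.inj₁-injective eq)
    close (inj₂ p) (inj₂ q) eq = closeG (_ , p) (_ , q) (Sum.inj₂-injective eq)

  -- The interval is closed so that its two halves cover it, midpoint included, and `total` can
  -- choose between them.
  WithDigits : ∀ {r} → (Fin r → ℕ) → Carrier → Carrier → Pred Carrier 0ℓ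
  WithDigits g u W y = (u ≤ y × y ≤ u + W) × ∀ k → Digit (g k) u W y

  module _ {u W w : Carrier} (0<W : 0# < W) where

    ¬lower : ∀ i {y} → u + half W ≤ y → ¬ Digit i u (half W) y
    ¬lower i m≤y y∈ = <⇒≱ (proj₂ (Digit-bounds i (half-pos 0<W) y∈)) m≤y

    ¬upper : ∀ i {y} → y ≤ u + half W → ¬ Digit i (u + half W) (half W) y
    ¬upper i y≤m y∈ = <⇒≱ (proj₁ (Digit-bounds i (half-pos 0<W) y∈)) y≤m

    -- The shape of the index is passed as an equation because the lemma is applied at `g k`, which
    -- does not reduce to a successor.
    upper-digit : ∀ {i j y} → i ≡ suc j → u + half W ≤ y → Digit i u W y → Digit j (u + half W) (half W) y
    upper-digit {j = j} ≡.refl m≤y (inj₁ y∈) = ⊥-elim (¬lower j m≤y y∈)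
    upper-digit         ≡.refl m≤y (inj₂ y∈) = y∈

    lower-digit : ∀ {i j y} → i ≡ suc j → y ≤ u + half W → Digit i u W y → Digit j u (half W) y
    lower-digit         ≡.refl y≤m (inj₁ y∈) = y∈
    lower-digit {j = j} ≡.refl y≤m (inj₂ y∈) = ⊥-elim (¬upper j y≤m y∈)

    capacity-halves : ∀ {r M N} {g g′ : Fin r → ℕ} → (∀ k → g k ≡ suc (g′ k)) →
      Capacity (WithDigits g′ u (half W)) w M →
      Capacity (WithDigits g′ (u + half W) (half W)) w N →
      Capacity (WithDigits g u W) w (M ℕ.+ N)
    capacity-halves eq = capacity-∪ λ { {y} ((u≤y , y≤r) , y∈) → Sum.map
      (λ y≤m → (u≤y , y≤m) , λ k → lower-digit (eq k) y≤m (y∈ k))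
      (λ m≤y → (m≤y , ≤-trans y≤r (≤-reflexive (sym (upper-end u W)))) , λ k → upper-digit (eq k) m≤y (y∈ k))
      (total y (u + half W)) }

    -- A leading digit 1 rules out the lower half, so only the upper half is counted; the remaining
    -- positions move up by one level.
    capacity-upper : ∀ {r N} {g : Fin (suc r) → ℕ} {g′ : Fin r → ℕ} →
      g zero ≡ 0 → (∀ k → g (suc k) ≡ suc (g′ k)) →
      Capacity (WithDigits g′ (u + half W) (half W)) w N →
      Capacity (WithDigits g u W) w N
    capacity-upper g0≡0 eq = capacity-⊆ λ { {y} ((u≤y , y≤r) , y∈) →
      let m≤y = <⇒≤ (proj₁ (≡.subst (λ i → Digit i u W y) g0≡0 (y∈ zero)))
      in (m≤y , ≤-trans y≤r (≤-reflexive (sym (upper-end u W)))) , λ k → upper-digit (eq k) m≤y (y∈ (suc k)) }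

  positive⇒suc-pred : ∀ {n} → 0 ℕ.< n → n ≡ suc (ℕ.pred n)
  positive⇒suc-pred (s≤s _) = ≡.refl

  pred-mono-< : ∀ {m n} → 0 ℕ.< m → m ℕ.< n → ℕ.pred m ℕ.< ℕ.pred n
  pred-mono-< (s≤s _) (s≤s m<n) = m<n

  -- Prescribing a digit halves the number of admissible dyadic cells.
  digits-capacity : ∀ m {r} (g : Fin r → ℕ) → (∀ {i j} → i Fin.< j → g i ℕ.< g j) → (∀ k → g k ℕ.< m) →
    ∀ u {W} → 0# < W → ∃ λ N → N ℕ.* 2 ℕ.^ r ℕ.≤ 2 ℕ.^ m × Capacity (WithDigits g u W) (halves m W) N
  digits-capacity zero {zero} g mono bound u 0<W =
    -- At depth 0 the whole interval is a single cell, and no position can be prescribed.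
    1 , ℕ.≤-refl , (λ _ → zero) , λ { (y , (u≤y , _) , _) (z , (_ , z≤r) , _) _ → ≤-trans z≤r (+-mono-≤ u≤y ≤-refl) }
  digits-capacity zero {suc r} g mono bound u 0<W = contradiction (bound zero) λ ()
  digits-capacity (suc m) {r} g mono bound u {W} 0<W = cases r g mono bound
    where
    shift : ∀ r (g : Fin r → ℕ) → (∀ {i j} → i Fin.< j → g i ℕ.< g j) → (∀ k → g k ℕ.< suc m) → (∀ k → 0 ℕ.< g k) →
      ∃ λ N → N ℕ.* 2 ℕ.^ r ℕ.≤ 2 ℕ.^ suc m × Capacity (WithDigits g u W) (halves (suc m) W) N
    shift r g mono bound pos =
      let g′ = ℕ.pred ∘ g
          mono′ : ∀ {i j} → i Fin.< j → g′ i ℕ.< g′ j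
          mono′ = λ i<j → pred-mono-< (pos _) (mono i<j)
          bound′ = λ k → pred-mono-< (pos k) (bound k)
          M , M≤ , capM = digits-capacity m g′ mono′ bound′ u (half-pos 0<W)
          N , N≤ , capN = digits-capacity m g′ mono′ bound′ (u + half W) (half-pos 0<W)
      in M ℕ.+ N ,
         ℕ.≤-trans (ℕ.≤-reflexive (ℕ.*-distribʳ-+ (2 ℕ.^ r) M N)) (ℕ.+-mono-≤ M≤ (ℕ.m≤n⇒m≤n+o 0 N≤)) ,
         capacity-halves 0<W (λ k → positive⇒suc-pred (pos k)) capM capN
    cases : ∀ r (g : Fin r → ℕ) → (∀ {i j} → i Fin.< j → g i ℕ.< g j) → (∀ k → g k ℕ.< suc m) →
      ∃ λ N → N ℕ.* 2 ℕ.^ r ℕ.≤ 2 ℕ.^ suc m × Capacity (WithDigits g u W) (halves (suc m) W) N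
    cases zero    g mono bound = shift zero g mono bound λ ()
    cases (suc r) g mono bound with g zero ℕ.≟ 0
    -- `g` increases, so if its first position is positive all are: the leading digit is free, and
    -- both halves contribute.
    ... | no  g0≢0 = shift (suc r) g mono bound λ
      { zero → ℕ.n≢0⇒n>0 g0≢0 ; (suc k) → ℕ.≤-<-trans z≤n (mono {zero} {suc k} (s≤s z≤n)) }
    ... | yes g0≡0 =
      let pos : ∀ k → 0 ℕ.< g (suc k)
          pos k = ℕ.≤-<-trans z≤n (mono {zero} {suc k} (s≤s z≤n))
          N , N≤ , cap = digits-capacity m (ℕ.pred ∘ g ∘ suc) (λ i<j → pred-mono-< (pos _) (mono (s≤s i<j)))
            (λ k → pred-mono-< (pos k) (bound (suc k))) (u + half W) (half-pos 0<W)
      in N ,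
         ℕ.≤-trans (ℕ.≤-reflexive (≡.trans (≡.sym (ℕ.*-assoc N 2 (2 ℕ.^ r)))
             (≡.trans (≡.cong (ℕ._* 2 ℕ.^ r) (ℕ.*-comm N 2)) (ℕ.*-assoc 2 N (2 ℕ.^ r)))))
           (ℕ.*-monoʳ-≤ 2 N≤) ,
         capacity-upper 0<W g0≡0 (λ k → positive⇒suc-pred (pos k)) cap

-- Lower bounds for the total area of a cover.

module CoveringByBoxes (em : ExcludedMiddle (Level.suc 0ℓ)) (ℝ : CompleteOrderedField) where
  open CompleteOrderedField ℝ hiding (zero)
  open Plane ℝ
  open Box
  open OrderedField em ℝ
  open Digits em ℝ
  open SumProperties +-commutativeMonoid using (sum; ∑-distrib-+; sum-cong-≋)

  sum-mono-≤ : ∀ {K} {f g : Fin K → Carrier} → (∀ i → f i ≤ g i) → sum f ≤ sum g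
  sum-mono-≤ {zero}  f≤g = ≤-refl
  sum-mono-≤ {suc K} f≤g = +-mono-≤ (f≤g zero) (sum-mono-≤ (f≤g ∘ suc))

  sum-nonNeg : ∀ {K} {f : Fin K → Carrier} → (∀ i → 0# ≤ f i) → 0# ≤ sum f
  sum-nonNeg {zero}  0≤f = ≤-refl
  sum-nonNeg {suc K} 0≤f = 0≤x+y (0≤f zero) (sum-nonNeg (0≤f ∘ suc))

  sum-extend : ∀ {J K} (f : ℕ → Carrier) → (∀ i → 0# ≤ f i) → J ℕ.≤ K →
    sum {J} (f ∘ toℕ) ≤ sum {K} (f ∘ toℕ)
  sum-extend {K = K} f 0≤f z≤n       = sum-nonNeg {K} (λ i → 0≤f (toℕ i))
  sum-extend f 0≤f (s≤s J≤K) = +-mono-≤ ≤-refl (sum-extend (f ∘ suc) (0≤f ∘ suc) J≤K)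

  term≤sum : ∀ (f : ℕ → Carrier) → (∀ i → 0# ≤ f i) → ∀ k → f k ≤ sum {suc k} (f ∘ toℕ)
  term≤sum f 0≤f zero    = ≤-reflexive (sym (+-identityʳ _))
  term≤sum f 0≤f (suc k) = begin
    f (suc k)                                    ≈⟨ sym (+-identityˡ _) ⟩
    0# + f (suc k)                               ≤⟨ +-mono-≤ (0≤f 0) (term≤sum (f ∘ suc) (0≤f ∘ suc) k) ⟩
    f 0 + sum {suc k} (f ∘ suc ∘ toℕ)            ∎
    where open ≤-Reasoning

  clamp : Carrier → Carrier → Carrier → Carrier
  clamp l r t = l ⊔ (t ⊓ r)

  clamp-mono : ∀ l r {s t} → s ≤ t → clamp l r s ≤ clamp l r t
  clamp-mono l r s≤t = ⊔-mono-≤ (≤-refl {l}) (⊓-mono-≤ s≤t (≤-refl {r}))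

  clamp-inside : ∀ {l r t} → l ≤ t → t ≤ r → clamp l r t ≈ t
  clamp-inside {l} {r} {t} l≤t t≤r = trans
    (x≤y⇒x⊔y≈y (≤-trans l≤t (≤-reflexive (sym (x≤y⇒x⊓y≈x t≤r))))) (x≤y⇒x⊓y≈x t≤r)

  clamp-≥ : ∀ l r t → l ≤ clamp l r t
  clamp-≥ l r t = x≤x⊔y l (t ⊓ r)

  clamp-≤ : ∀ {l r} t → l ≤ r → clamp l r t ≤ r
  clamp-≤ {l} {r} t l≤r = ⊔-lub l≤r (x⊓y≤y t r)

  -- The area of the part of the box B inside [a , b] × [c , d]; writing it
  -- with clamp makes additivity in the rectangle a telescoping identity.
  mass : Box → (a b c d : Carrier) → Carrier
  mass B a b c d =
    (clamp (left B) (right B) b - clamp (left B) (right B) a) *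
    (clamp (bottom B) (top B) d - clamp (bottom B) (top B) c)

  module _ (B : Box) where
    private
      X = clamp (left B) (right B)
      Y = clamp (bottom B) (top B)

    mass-nonNeg : ∀ {a b c d} → a ≤ b → c ≤ d → 0# ≤ mass B a b c d
    mass-nonNeg a≤b c≤d = *-nonNeg (x≤y⇒0≤y-x (clamp-mono _ _ a≤b)) (x≤y⇒0≤y-x (clamp-mono _ _ c≤d))

    mass-mono : ∀ {a b c d a′ b′ c′ d′} → a ≤ b → c ≤ d →
      a′ ≤ a → b ≤ b′ → c′ ≤ c → d ≤ d′ → mass B a b c d ≤ mass B a′ b′ c′ d′
    mass-mono {a} {b} {c} {d} a≤b c≤d a′≤a b≤b′ c′≤c d≤d′ = *-mono-≤
      (x≤y⇒0≤y-x (clamp-mono _ _ a≤b))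
      (x≤y⇒0≤y-x (clamp-mono _ _ (≤-trans c′≤c (≤-trans c≤d d≤d′))))
      (sub-mono-≤ (clamp-mono _ _ b≤b′) (clamp-mono _ _ a′≤a))
      (sub-mono-≤ (clamp-mono _ _ d≤d′) (clamp-mono _ _ c′≤c))

    mass-splitˣ : ∀ a b e c d → mass B a b c d + mass B b e c d ≈ mass B a e c d
    mass-splitˣ a b e c d = solve 5
      (λ a b e c d → (b :- a) :* (d :- c) :+ (e :- b) :* (d :- c) := (e :- a) :* (d :- c))
      refl (X a) (X b) (X e) (Y c) (Y d)

    mass-splitʸ : ∀ a b c d e → mass B a b c d + mass B a b d e ≈ mass B a b c e
    mass-splitʸ a b c d e = solve 5
      (λ a b c d e → (b :- a) :* (d :- c) :+ (b :- a) :* (e :- d) := (b :- a) :* (e :- c))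
      refl (X a) (X b) (Y c) (Y d) (Y e)

    -- Clamped coordinates never leave the sides of the box.
    mass≤area : ∀ {a b c d} → a ≤ b → mass B a b c d ≤ area B
    mass≤area {a} {b} {c} {d} a≤b = *-mono-≤
      (x≤y⇒0≤y-x (clamp-mono _ _ a≤b)) (x≤y⇒0≤y-x (bottom≤top B))
      (sub-mono-≤ (clamp-≤ b (left≤right B)) (clamp-≥ _ _ a))
      (sub-mono-≤ (clamp-≤ d (bottom≤top B)) (clamp-≥ _ _ c))

    mass-inside : ∀ {a A c C} → 0# ≤ A → 0# ≤ C → left B ≤ a → a + A ≤ right B →
      bottom B ≤ c → c + C ≤ top B → mass B a (a + A) c (c + C) ≈ A * C
    mass-inside {a} {A} {c} {C} 0≤A 0≤C l≤a b≤r l≤c d≤t = begin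
      (X (a + A) - X a) * (Y (c + C) - Y c)
        ≈⟨ *-cong (+-cong (clamp-inside (≤-trans l≤a (x≤x+y 0≤A)) b≤r)
                          (-‿cong (clamp-inside l≤a (≤-trans (x≤x+y 0≤A) b≤r))))
                  (+-cong (clamp-inside (≤-trans l≤c (x≤x+y 0≤C)) d≤t)
                          (-‿cong (clamp-inside l≤c (≤-trans (x≤x+y 0≤C) d≤t)))) ⟩
      (a + A - a) * (c + C - c)
        ≈⟨ solve 4 (λ a A c C → (a :+ A :- a) :* (c :+ C :- c) := A :* C) refl a A c C ⟩
      A * C  ∎
      where open SetoidReasoning setoid

  module Cover (B : ℕ → Box) where

    Covered : Pred Point 0ℓ
    Covered p = ∃ λ k → p ∈ interior (B k)

    massUpTo : ℕ → (a b c d : Carrier) → Carrier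
    massUpTo K a b c d = sum {K} (λ i → mass (B (toℕ i)) a b c d)

    massUpTo-mono : ∀ {J K a b c d a′ b′ c′ d′} → J ℕ.≤ K → a ≤ b → c ≤ d →
      a′ ≤ a → b ≤ b′ → c′ ≤ c → d ≤ d′ → massUpTo J a b c d ≤ massUpTo K a′ b′ c′ d′
    massUpTo-mono {K = K} J≤K a≤b c≤d a′≤a b≤b′ c′≤c d≤d′ = ≤-trans
      (sum-extend (λ i → mass (B i) _ _ _ _) (λ i → mass-nonNeg (B i) a≤b c≤d) J≤K)
      (sum-mono-≤ {K} λ i → mass-mono (B (toℕ i)) a≤b c≤d a′≤a b≤b′ c′≤c d≤d′)

    -- Both sums are extended to the larger index and then added box by box. The slack from `e` to
    -- `e′` absorbs end points that agree only up to `≈`.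
    massUpTo-superadditiveˣ : ∀ {J K a b e e′ c d x y} → a ≤ b → b ≤ e → e ≤ e′ → c ≤ d →
      x ≤ massUpTo J a b c d → y ≤ massUpTo K b e c d → x + y ≤ massUpTo (J ℕ.⊔ K) a e′ c d
    massUpTo-superadditiveˣ {J} {K} {a} {b} {e} {e′} {c} {d} {x} {y} a≤b b≤e e≤e′ c≤d x≤ y≤ = begin
      x + y                                      ≤⟨ +-mono-≤ x≤ y≤ ⟩
      massUpTo J a b c d + massUpTo K b e c d    ≤⟨ +-mono-≤
        (massUpTo-mono (ℕ.m≤m⊔n J K) a≤b c≤d ≤-refl ≤-refl ≤-refl ≤-refl)
        (massUpTo-mono (ℕ.m≤n⊔m J K) b≤e c≤d ≤-refl ≤-refl ≤-refl ≤-refl) ⟩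
      massUpTo M a b c d + massUpTo M b e c d    ≈⟨ sym (∑-distrib-+ {M} _ _) ⟩
      sum {M} (λ i → mass (B (toℕ i)) a b c d + mass (B (toℕ i)) b e c d)
                                                 ≈⟨ sum-cong-≋ {M} (λ i → mass-splitˣ (B (toℕ i)) a b e c d) ⟩
      massUpTo M a e c d                         ≤⟨ massUpTo-mono (ℕ.≤-refl {M}) (≤-trans a≤b b≤e) c≤d ≤-refl e≤e′ ≤-refl ≤-refl ⟩
      massUpTo M a e′ c d                        ∎
      where
      open ≤-Reasoning
      M = J ℕ.⊔ K

    massUpTo-superadditiveʸ : ∀ {J K a b c d e e′ x y} → a ≤ b → c ≤ d → d ≤ e → e ≤ e′ →
      x ≤ massUpTo J a b c d → y ≤ massUpTo K a b d e → x + y ≤ massUpTo (J ℕ.⊔ K) a b c e′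
    massUpTo-superadditiveʸ {J} {K} {a} {b} {c} {d} {e} {e′} {x} {y} a≤b c≤d d≤e e≤e′ x≤ y≤ = begin
      x + y                                      ≤⟨ +-mono-≤ x≤ y≤ ⟩
      massUpTo J a b c d + massUpTo K a b d e    ≤⟨ +-mono-≤
        (massUpTo-mono (ℕ.m≤m⊔n J K) a≤b c≤d ≤-refl ≤-refl ≤-refl ≤-refl)
        (massUpTo-mono (ℕ.m≤n⊔m J K) a≤b d≤e ≤-refl ≤-refl ≤-refl ≤-refl) ⟩
      massUpTo M a b c d + massUpTo M a b d e    ≈⟨ sym (∑-distrib-+ {M} _ _) ⟩
      sum {M} (λ i → mass (B (toℕ i)) a b c d + mass (B (toℕ i)) a b d e)
                                                 ≈⟨ sum-cong-≋ {M} (λ i → mass-splitʸ (B (toℕ i)) a b c d e) ⟩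
      massUpTo M a b c e                         ≤⟨ massUpTo-mono (ℕ.≤-refl {M}) a≤b (≤-trans c≤d d≤e) ≤-refl ≤-refl ≤-refl e≤e′ ⟩
      massUpTo M a b c e′                        ∎
      where
      open ≤-Reasoning
      M = J ℕ.⊔ K

    -- This takes the place of a finite subcover: finitely many boxes already account for the area
    -- of the rectangle. As an inequality between areas it passes from the two halves to the whole.
    Full : (a A c C : Carrier) → Set
    Full a A c C = ∃ λ K → A * C ≤ massUpTo K a (a + A) c (c + C)

    full-halvesˣ : ∀ {a A c C} → 0# < A → 0# ≤ C →
      Full a (half A) c C → Full (a + half A) (half A) c C → Full a A c C
    full-halvesˣ {a} {A} {c} {C} 0<A 0≤C (J , J-full) (K , K-full) = J ℕ.⊔ K , (begin
      A * C                      ≈⟨ *-congʳ (sym (half+half A)) ⟩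
      (half A + half A) * C      ≈⟨ distribʳ C (half A) (half A) ⟩
      half A * C + half A * C    ≤⟨ massUpTo-superadditiveˣ {J} {K} x≤x+hA x≤x+hA (≤-reflexive (upper-end a A)) (x≤x+y 0≤C) J-full K-full ⟩
      massUpTo (J ℕ.⊔ K) a (a + A) c (c + C)  ∎)
      where
      open ≤-Reasoning
      x≤x+hA : ∀ {x} → x ≤ x + half A
      x≤x+hA = x≤x+y (<⇒≤ (half-pos 0<A))

    full-halvesʸ : ∀ {a A c C} → 0# ≤ A → 0# < C →
      Full a A c (half C) → Full a A (c + half C) (half C) → Full a A c C
    full-halvesʸ {a} {A} {c} {C} 0≤A 0<C (J , J-full) (K , K-full) = J ℕ.⊔ K , (begin
      A * C                      ≈⟨ *-congˡ (sym (half+half C)) ⟩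
      A * (half C + half C)      ≈⟨ distribˡ A (half C) (half C) ⟩
      A * half C + A * half C    ≤⟨ massUpTo-superadditiveʸ {J} {K} (x≤x+y 0≤A) x≤x+hC x≤x+hC (≤-reflexive (upper-end c C)) J-full K-full ⟩
      massUpTo (J ℕ.⊔ K) a (a + A) c (c + C)  ∎)
      where
      open ≤-Reasoning
      x≤x+hC : ∀ {x} → x ≤ x + half C
      x≤x+hC = x≤x+y (<⇒≤ (half-pos 0<C))

    Within : (a A a′ A′ : Carrier) → Set
    Within a A a′ A′ = a ≤ a′ × a′ + A′ ≤ a + A

    lower-within : ∀ {a A} → 0# < A → Within a A a (half A)
    lower-within 0<A = ≤-refl , <⇒≤ (half-end 0<A)

    upper-within : ∀ {a A} → 0# < A → Within a A (a + half A) (half A)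
    upper-within 0<A = x≤x+y (<⇒≤ (half-pos 0<A)) , ≤-reflexive (upper-end _ _)

    bisect : ∀ {a A c C} → 0# < A → 0# < C → ¬ Full a A c C →
      ∃₂ λ a′ c′ → ¬ Full a′ (half A) c′ (half C) × Within a A a′ (half A) × Within c C c′ (half C)
    bisect {a} {A} {c} {C} 0<A 0<C ¬full
      with decide (Full a (half A) c (half C)) | decide (Full a (half A) (c + half C) (half C))
         | decide (Full (a + half A) (half A) c (half C)) | decide (Full (a + half A) (half A) (c + half C) (half C))
    ... | no ¬f | _     | _     | _     = _ , _ , ¬f , lower-within 0<A , lower-within 0<C
    ... | yes _ | no ¬f | _     | _     = _ , _ , ¬f , lower-within 0<A , upper-within 0<C
    ... | yes _ | yes _ | no ¬f | _     = _ , _ , ¬f , upper-within 0<A , lower-within 0<C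
    ... | yes _ | yes _ | yes _ | no ¬f = _ , _ , ¬f , upper-within 0<A , upper-within 0<C
    ... | yes f | yes g | yes h | yes k = contradiction
      (full-halvesˣ 0<A (<⇒≤ 0<C) (full-halvesʸ 0≤hA 0<C f g) (full-halvesʸ 0≤hA 0<C h k)) ¬full
      where
      0≤hA = <⇒≤ (half-pos 0<A)

    -- Otherwise bisection yields nested rectangles that are not full and
    -- shrink to a point, but a rectangle inside a single box is full.
    covered⇒full : ∀ {a A c C} → 0# < A → 0# < C →
      (∀ x y → a ≤ x × x ≤ a + A → c ≤ y × y ≤ c + C → Covered (x , y)) → Full a A c C
    covered⇒full {a} {A} {c} {C} 0<A 0<C covered = by-contradiction λ ¬full → shrink ¬full
      where
      Corner : ℕ → Set
      Corner k = ∃₂ λ x y → ¬ Full x (halves k A) y (halves k C)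

      next : ∀ k ((x , y , _) : Corner k) → ∃ λ ((x′ , y′ , _) : Corner (suc k)) →
        Within x (halves k A) x′ (halves (suc k) A) × Within y (halves k C) y′ (halves (suc k) C)
      -- Bisection produces `half (halves k A)`, whereas `halves (suc k) A` computes to
      -- `halves k (half A)`.
      next k (x , y , ¬f) rewrite halves-half k A | halves-half k C =
        let x′ , y′ , ¬f′ , withinˣ , withinʸ = bisect (halves-pos k 0<A) (halves-pos k 0<C) ¬f
        in (x′ , y′ , ¬f′) , withinˣ , withinʸ

      module _ (¬full : ¬ Full a A c C) where
        corner : ∀ k → Corner k
        corner zero    = a , c , ¬full
        corner (suc k) = proj₁ (next k (corner k))

        x y : ℕ → Carrier
        x k = proj₁ (corner k)
        y k = proj₁ (proj₂ (corner k))

        pˣ = nested-intervals x (λ k → x k + halves k A) (λ k → x≤x+y (<⇒≤ (halves-pos k 0<A)))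
               (λ k → proj₁ (proj₁ (proj₂ (next k (corner k))))) (λ k → proj₂ (proj₁ (proj₂ (next k (corner k)))))
        pʸ = nested-intervals y (λ k → y k + halves k C) (λ k → x≤x+y (<⇒≤ (halves-pos k 0<C)))
               (λ k → proj₁ (proj₂ (proj₂ (next k (corner k))))) (λ k → proj₂ (proj₂ (proj₂ (next k (corner k)))))

        after : ∀ {p l s w} → p ≤ s + w → w ≤ p - l → l ≤ s
        after {p} {l} {s} {w} p≤s+w w≤p-l = ≤-by ((s + w - p) + (p - l - w))
          (0≤x+y (x≤y⇒0≤y-x p≤s+w) (x≤y⇒0≤y-x w≤p-l))
          (solve 4 (λ p l s w → (s :+ w :- p) :+ (p :- l :- w) := s :- l) refl p l s w)

        before : ∀ {p r s w} → s ≤ p → w ≤ r - p → s + w ≤ r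
        before {p} {r} {s} {w} s≤p w≤r-p = ≤-by ((p - s) + (r - p - w))
          (0≤x+y (x≤y⇒0≤y-x s≤p) (x≤y⇒0≤y-x w≤r-p))
          (solve 4 (λ p r s w → (p :- s) :+ (r :- p :- w) := r :- (s :+ w)) refl p r s w)

        full-inside : ∀ p q → (∀ k → x k ≤ p × p ≤ x k + halves k A) → (∀ k → y k ≤ q × q ≤ y k + halves k C) →
          Covered (p , q) → ⊥
        full-inside p q p-in q-in (j , (l<p , p<r) , (b<q , q<t)) = proj₂ (proj₂ (corner k))
          (suc j , (begin
            w * v                                                ≈⟨ sym (mass-inside (B j) 0≤w 0≤v
                after-left before-right after-bottom before-top) ⟩
            mass (B j) (x k) (x k + w) (y k) (y k + v)           ≤⟨ term≤sum
                (λ i → mass (B i) (x k) (x k + w) (y k) (y k + v))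
                (λ i → mass-nonNeg (B i) (x≤x+y 0≤w) (x≤x+y 0≤v)) j ⟩
            massUpTo (suc j) (x k) (x k + w) (y k) (y k + v)     ∎))
          where
          open ≤-Reasoning
          -- `ε` is the distance from the limit point to the nearest side of a box containing it;
          -- halving `A ⊔ C` lets one `k` serve both sides of the rectangle.
          εˣ = (p - left (B j)) ⊓ (right (B j) - p)
          εʸ = (q - bottom (B j)) ⊓ (top (B j) - q)
          ε  = εˣ ⊓ εʸ
          small = halves-small {ε} {A ⊔ C}
            (z<x⊓y (z<x⊓y (x<y⇒0<y-x l<p) (x<y⇒0<y-x p<r)) (z<x⊓y (x<y⇒0<y-x b<q) (x<y⇒0<y-x q<t)))
            (<-≤-trans 0<A (x≤x⊔y A C))
          k = proj₁ small
          w = halves k A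
          v = halves k C
          0≤w = <⇒≤ (halves-pos k 0<A)
          0≤v = <⇒≤ (halves-pos k 0<C)
          w≤εˣ : w ≤ εˣ
          w≤εˣ = ≤-trans (halves-mono-≤ k (x≤x⊔y A C)) (≤-trans (<⇒≤ (proj₂ small)) (x⊓y≤x εˣ εʸ))
          v≤εʸ : v ≤ εʸ
          v≤εʸ = ≤-trans (halves-mono-≤ k (x≤y⊔x A C)) (≤-trans (<⇒≤ (proj₂ small)) (x⊓y≤y εˣ εʸ))
          after-left   = after (proj₂ (p-in k)) (≤-trans w≤εˣ (x⊓y≤x _ _))
          before-right = before (proj₁ (p-in k)) (≤-trans w≤εˣ (x⊓y≤y _ _))
          after-bottom = after (proj₂ (q-in k)) (≤-trans v≤εʸ (x⊓y≤x _ _))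
          before-top   = before (proj₁ (q-in k)) (≤-trans v≤εʸ (x⊓y≤y _ _))

        shrink : ⊥
        shrink = let p , p-in = pˣ
                     q , q-in = pʸ
                 in full-inside p q p-in q-in (covered p q (p-in 0) (q-in 0))

    -- A quarter of the height survives for every `i`: one half is the density of the digit, the
    -- other is the loss in passing to closed intervals. At `suc i` the two halves of the interval
    -- contribute equally.
    digit-mass : ∀ i {a A u W} → 0# < A → 0# < W →
      (∀ x y → a ≤ x × x ≤ a + A → Digit i u W y → Covered (x , y)) →
      ∃ λ K → A * half (half W) ≤ massUpTo K a (a + A) u (u + W)
    digit-mass zero {a} {A} {u} {W} 0<A 0<W covered =
      -- The points with digit 1 form the open interval (m , m + H); its closed middle half, from m
      -- + H/4 to m + 3H/4, is the part used.
      let K , full = covered⇒full {c = m + q} {C = half H} 0<A 0<hH λ x y x∈ (lo , hi) →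
            covered x y x∈ (<-≤-trans (x<x+y 0<q) lo , ≤-<-trans hi end)
      in K , ≤-trans full (massUpTo-mono (ℕ.≤-refl {K}) (x≤x+y (<⇒≤ 0<A)) (x≤x+y (<⇒≤ 0<hH)) ≤-refl ≤-refl
           (≤-trans (x≤x+y (<⇒≤ 0<H)) (x≤x+y (<⇒≤ 0<q))) (<⇒≤ end))
      where
      H = half W
      q = half (half H)
      m = u + H
      0<H = half-pos 0<W
      0<hH = half-pos 0<H
      0<q = half-pos 0<hH
      end : m + q + half H < u + W
      end = begin-strict
        m + q + half H           ≈⟨ solve 3 (λ m q h → m :+ q :+ h := q :+ (m :+ h)) refl m q (half H) ⟩
        q + (m + half H)         <⟨ +-monoˡ-< (m + half H) (half<x 0<hH) ⟩
        half H + (m + half H)    ≈⟨ solve 2 (λ m h → h :+ (m :+ h) := m :+ h :+ h) refl m (half H) ⟩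
        m + half H + half H      ≈⟨ upper-end m H ⟩
        m + H                    ≈⟨ upper-end u W ⟩
        u + W                    ∎
        where open ≤-Reasoning
    digit-mass (suc i) {a} {A} {u} {W} 0<A 0<W covered =
      let J , J≤ = digit-mass i 0<A 0<H (λ x y x∈ y∈ → covered x y x∈ (inj₁ y∈))
          K , K≤ = digit-mass i 0<A 0<H (λ x y x∈ y∈ → covered x y x∈ (inj₂ y∈))
      in J ℕ.⊔ K , ≤-trans
           (≤-reflexive (trans (*-congˡ (sym (half+half (half H)))) (distribˡ A (half (half H)) (half (half H)))))
           (massUpTo-superadditiveʸ {J} {K} (x≤x+y (<⇒≤ 0<A)) (x≤x+y (<⇒≤ 0<H)) (x≤x+y (<⇒≤ 0<H))
             (≤-reflexive (upper-end u W)) J≤ K≤)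
      where
      H = half W
      0<H = half-pos 0<W

    rows-mass : ∀ m {h u W} → 0# < h → 0# < W →
      (∀ i → i ℕ.< m → ∀ x y → i · h < x × x < suc i · h → Digit i u W y → Covered (x , y)) →
      ∃ λ K → m · (half h * half (half W)) ≤ massUpTo K 0# (m · h) u (u + W)
    rows-mass zero {h} {u} {W} 0<h 0<W covered =
      0 , ≤-refl
    rows-mass (suc i) {h} {u} {W} 0<h 0<W covered =
      let J , J≤ = rows-mass i 0<h 0<W (λ j j<i → covered j (ℕ.m<n⇒m<1+n j<i))
          -- Again the closed middle half of an open interval is used, now in the abscissa, whence
          -- the width `half h`.
          K , K≤ = digit-mass i {i · h + q} (half-pos 0<h) 0<W λ x y (lo , hi) →
            covered i ℕ.≤-refl x y (<-≤-trans (x<x+y 0<q) lo , ≤-<-trans hi end)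
      in J ℕ.⊔ K , ≤-trans (≤-reflexive (+-comm _ _))
           (massUpTo-superadditiveˣ {J} {K} (·-nonNeg i (<⇒≤ 0<h)) (≤-trans (x≤x+y (<⇒≤ 0<h)) (≤-reflexive (+-comm (i · h) h))) ≤-refl
             (x≤x+y (<⇒≤ 0<W)) J≤
             (≤-trans K≤ (massUpTo-mono (ℕ.≤-refl {K}) (x≤x+y (<⇒≤ (half-pos 0<h))) (x≤x+y (<⇒≤ 0<W))
               (x≤x+y (<⇒≤ 0<q)) (<⇒≤ end) ≤-refl ≤-refl)))
      where
      q = half (half h)
      0<q = half-pos (half-pos 0<h)
      end : i · h + q + half h < suc i · h
      end = begin-strict
        i · h + q + half h        ≈⟨ solve 3 (λ m q h → m :+ q :+ h := q :+ (m :+ h)) refl (i · h) q (half h) ⟩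
        q + (i · h + half h)      <⟨ +-monoˡ-< _ (half<x (half-pos 0<h)) ⟩
        half h + (i · h + half h) ≈⟨ solve 2 (λ m h → h :+ (m :+ h) := h :+ h :+ m) refl (i · h) (half h) ⟩
        half h + half h + i · h   ≈⟨ +-congʳ (half+half h) ⟩
        h + i · h                 ∎
        where open ≤-Reasoning

    massUpTo≤area : ∀ K {a b c d} → a ≤ b → massUpTo K a b c d ≤ sum {K} (λ i → area (B (toℕ i)))
    massUpTo≤area K a≤b = sum-mono-≤ {K} λ i → mass≤area (B (toℕ i)) a≤b

-- The set of rows contains no copy of the rational points.

module SetOfRows (em : ExcludedMiddle (Level.suc 0ℓ)) (ℝ : CompleteOrderedField) where
  open CompleteOrderedField ℝ hiding (zero)
  open Plane ℝ
  open Box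
  open OrderedField em ℝ
  open RationalPointsOfIntervals em ℝ
  open Digits em ℝ

  -- A row is a vertical strip, that is, a range of abscissae; the lines x = i · h are left out to
  -- keep the set open.
  Rows : ℕ → Carrier → Carrier → Subset
  Rows m h n (x , y) = ∃ λ i → i ℕ.< m × (i · h < x × x < suc i · h) × Digit i 0# n y

  Rows-open : ∀ {m h n} → 0# < h → Open (Rows m h n)
  Rows-open {h = h} 0<h (x , y) (i , i<m , (l<x , x<r) , y∈) =
    let b , t , (b<y , y<t) , inside = Digit-open i y∈
    in record
         { left = i · h ; right = suc i · h ; bottom = b ; top = t
         ; left≤right = <⇒≤ (<-trans l<x x<r) ; bottom≤top = <⇒≤ (<-trans b<y y<t) } ,
       ((l<x , x<r) , (b<y , y<t)) ,
       λ { {x′ , y′} (x′∈ , (b<y′ , y′<t)) → i , i<m , x′∈ , inside y′ b<y′ y′<t }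

  Rows-⊆-Square : ∀ {m h n} → 0# < h → 0# < n → m · h ≈ n → Rows m h n ⊆ Square n
  Rows-⊆-Square {m} {h} {n} 0<h 0<n mh≈n {x , y} (i , i<m , (l<x , x<r) , y∈) =
    let 0<y , y<n = Digit-bounds i 0<n y∈
    in (≤-trans (·-nonNeg i (<⇒≤ 0<h)) (<⇒≤ l<x) ,
        ≤-trans (<⇒≤ x<r) (≤-trans (·-monoˡ-≤ (<⇒≤ 0<h) i<m) (≤-reflexive mh≈n))) ,
       (<⇒≤ 0<y , ≤-trans (<⇒≤ y<n) (≤-reflexive (+-identityˡ n)))

  -- Membership persists on an open interval, whose two strict inequalities respect `≈`.
  Digit-resp-≈ : ∀ i {u W y z} → y ≈ z → Digit i u W y → Digit i u W z
  Digit-resp-≈ i y≈z y∈ =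
    let _ , _ , (a<y , y<b) , inside = Digit-open i y∈
    in inside _ (<-respʳ-≈ y≈z a<y) (<-respˡ-≈ y≈z y<b)

  row-≤ : ∀ {i j h x} → 0# < h → i · h < x → x < suc j · h → i ℕ.≤ j
  row-≤ 0<h ih<x x<[1+j]h = ℕ.≤-pred (·-cancelˡ-< (<⇒≤ 0<h) (<-trans ih<x x<[1+j]h))

  -- Slope at least 1 means that the difference of the images is at least the difference of the
  -- arguments.
  expansion-gap : ∀ {A B : Pred Carrier 0ℓ} (f : Func ⟦ A ⟧ ⟦ B ⟧) → SlopesAtLeast1 f →
    ∀ {w} s t → 0# ≤ w → proj₁ t + w < proj₁ s → proj₁ (Func.to f t) + w < proj₁ (Func.to f s)
  expansion-gap f slopes {w} s t 0≤w t+w<s = <-by (S - T - (s₀ - t₀) + (s₀ - (t₀ + w)))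
    (<-respʳ-≈ (+-comm _ _) (0<x+y (x<y⇒0<y-x t+w<s) (x≤y⇒0≤y-x
      (1≤x÷y⇒y≤x (x<y⇒0<y-x t<s) (slopes s t t<s)))))
    (solve 5 (λ S T s t w → S :- T :- (s :- t) :+ (s :- (t :+ w)) := S :- (T :+ w)) refl S T s₀ t₀ w)
    where
    s₀ = proj₁ s
    t₀ = proj₁ t
    S = proj₁ (Func.to f s)
    T = proj₁ (Func.to f t)
    t<s : t₀ < s₀
    t<s = ≤-<-trans (x≤x+y 0≤w) t+w<s

  module _ {P : Subset} (D : Box) (D⊆P : interior D ⊆ P) {n h : Carrier} (0<n : 0# < n) (0<h : 0# < h)
    (ρ : ℕ) (wide : n < ρ · (right D - left D)) (tall : n < ρ · (top D - bottom D))
    (mh≈n : (ρ ℕ.* ρ) · h ≈ n) where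

    private
      m = ρ ℕ.* ρ
      w = halves m n
      0≤w = <⇒≤ (halves-pos m 0<n)

      -- Since ρ · (ρ · h) ≈ n < ρ · width, a factor ρ cancels; this is why there are ρ² rows.
      ρh<width : ρ · h < right D - left D
      ρh<width = ·-cancelʳ-< ρ (<-respˡ-≈ (sym (trans (×-assocˡ h ρ ρ) mh≈n)) wide)

      abscissae = separated-rationals ρ (<⇒≤ 0<h) ρh<width
      x = proj₁ abscissae
      x-prop = proj₁ (proj₂ abscissae)
      x-sep = proj₂ (proj₂ abscissae)

      0<height : 0# < top D - bottom D
      0<height = ·-cancelʳ-< ρ (≤-<-trans (≤-trans (≤-reflexive (trans (k·x≈[k·1]*x ρ 0#) (zeroʳ _))) (<⇒≤ 0<n)) tall)

      Inner : Carrier → Set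
      Inner y = IsRational y × bottom D < y × y < top D

      member : ∀ k {y} → Inner y → (x k , y) ∈ RationalPoints P
      member k (y∈ℚ , b<y , y<t) = let x∈ℚ , l<x , x<r = x-prop k in D⊆P ((l<x , x<r) , (b<y , y<t)) , x∈ℚ , y∈ℚ

      -- 2^(ρ+1) copies of N · w amount to at most n, which is below ρ heights and hence below
      -- 2^(ρ+1) heights.
      Nw<height : ∀ {N} → N ℕ.* 2 ℕ.^ suc ρ ℕ.≤ 2 ℕ.^ m → N · w < top D - bottom D
      Nw<height {N} N≤ = ·-cancelʳ-< (2 ℕ.^ suc ρ) (begin-strict
        (2 ℕ.^ suc ρ) · (N · w)               ≈⟨ ×-assocˡ w (2 ℕ.^ suc ρ) N ⟩
        (2 ℕ.^ suc ρ ℕ.* N) · w               ≡⟨ ≡.cong (_· w) (ℕ.*-comm (2 ℕ.^ suc ρ) N) ⟩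
        (N ℕ.* 2 ℕ.^ suc ρ) · w               ≤⟨ ·-monoˡ-≤ 0≤w N≤ ⟩
        (2 ℕ.^ m) · w                         ≈⟨ 2^k·halves m n ⟩
        n                                     <⟨ tall ⟩
        ρ · (top D - bottom D)                ≤⟨ ·-monoˡ-≤ (<⇒≤ 0<height) (ℕ.<⇒≤ (ℕ.<-trans (ℕ.n<1+n ρ) (n<2^n (suc ρ)))) ⟩
        (2 ℕ.^ suc ρ) · (top D - bottom D)    ∎)
        where open ≤-Reasoning

    Rows-free : Rows m h n IsFreeOf RationalPoints P
    Rows-free contains = too-many-ordinates
      where
      open _Contains_ contains

      y₀-prop : ∃ Inner
      y₀-prop = rational-between
        (<-by (top D - bottom D) 0<height refl)

      X : Fin (suc ρ) → ∀ {y} → Inner y → Carrier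
      X k {y} y∈ = proj₁ (Func.to fX (x k , y , member k y∈))

      Y : Fin (suc ρ) → ∀ {y} → Inner y → Carrier
      Y k {y} y∈ = proj₁ (Func.to fY (y , x k , member k y∈))

      image : ∀ k {y} (y∈ : Inner y) → (X k y∈ , Y k y∈) ∈ Rows m h n
      image k y∈ = maps _ _ (member k y∈)

      -- The rows are read off at one reference ordinate; `same-row` shows that any other would give
      -- the same list.
      g : Fin (suc ρ) → ℕ
      g k = proj₁ (image k (proj₂ y₀-prop))

      g-bound : ∀ k → g k ℕ.< m
      g-bound k = proj₁ (proj₂ (image k (proj₂ y₀-prop)))

      g-row : ∀ k → g k · h < X k (proj₂ y₀-prop) × X k (proj₂ y₀-prop) < suc (g k) · h
      g-row k = proj₁ (proj₂ (proj₂ (image k (proj₂ y₀-prop))))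

      -- A gap above `h`, the width of a row, carries the later image past the right end of the row
      -- of the earlier one.
      g-mono : ∀ {i j} → i Fin.< j → g i ℕ.< g j
      g-mono {i} {j} i<j = row-≤ 0<h (begin-strict
        h + g i · h                     ≈⟨ +-comm h _ ⟩
        g i · h + h                     <⟨ +-monoˡ-< h (proj₁ (g-row i)) ⟩
        X i (proj₂ y₀-prop) + h         <⟨ expansion-gap fX slopesX _ _ (<⇒≤ 0<h) (x-sep i<j) ⟩
        X j (proj₂ y₀-prop)             ∎) (proj₂ (g-row j))
        where open ≤-Reasoning

      -- `fX` sees the abscissa alone, so a change of ordinate preserves `X k` up to `≈`, and
      -- distinct rows are disjoint.
      same-row : ∀ k {y} (y∈ : Inner y) → proj₁ (image k y∈) ≡ g k
      same-row k y∈ =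
        let _ , _ , (l<X , X<r) , _ = image k y∈
            X≈ = Func.cong fX {x k , _ , member k y∈} {x k , _ , member k (proj₂ y₀-prop)} refl
        in ℕ.≤-antisym (row-≤ 0<h (<-respʳ-≈ X≈ l<X) (proj₂ (g-row k)))
                       (row-≤ 0<h (proj₁ (g-row k)) (<-respˡ-≈ X≈ X<r))

      -- `fY` ignores the abscissa in the same way: every `Y k` agrees with `Y zero`, which
      -- therefore collects the digits of all the rows.
      digits : ∀ {y} (y∈ : Inner y) k → Digit (g k) 0# n (Y zero y∈)
      digits y∈ k = ≡.subst (λ i → Digit i 0# n (Y zero y∈)) (same-row k y∈)
        (Digit-resp-≈ _ (Func.cong fY {_ , x k , member k y∈} {_ , x zero , member zero y∈} refl)
          (proj₂ (proj₂ (proj₂ (image k y∈)))))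

      with-digits : ∀ {y} (y∈ : Inner y) → WithDigits g 0# n (Y zero y∈)
      with-digits y∈ =
        let 0<Y , Y<n = Digit-bounds (g zero) 0<n (digits y∈ zero) in (<⇒≤ 0<Y , <⇒≤ Y<n) , digits y∈

      too-many-ordinates : ⊥
      too-many-ordinates =
        let N , N≤ , code , close = digits-capacity m g g-mono g-bound 0# 0<n
            -- These are N + 1 ordinates with gaps above the cell length `w`, one more than there
            -- are codes.
            y , y-prop , y-sep = separated-rationals N 0≤w (Nw<height {N} N≤)
            z : Fin (suc N) → ∃ (WithDigits g 0# n)
            z j = _ , with-digits (y-prop j)
            i , j , i<j , same = Fin.pigeonhole (ℕ.n<1+n N) (code ∘ z)
        in <⇒≱ (expansion-gap fY slopesY _ _ 0≤w (y-sep i<j)) (close (z i) (z j) same)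

-- Existence of opx and its two bounds.

module OpxBounds (em : ExcludedMiddle (Level.suc 0ℓ)) (ℝ : CompleteOrderedField) where
  open CompleteOrderedField ℝ hiding (zero)
  open Plane ℝ
  open Box
  open OrderedField em ℝ
  open Digits em ℝ
  open CoveringByBoxes em ℝ
  open SetOfRows em ℝ
  open SumProperties +-commutativeMonoid using (sum)

  -- 1/8 is the digit density 1/2, halved once in each direction by the passage to closed middle
  -- halves. 9 comes from the square of side 3n used as a cover.
  C₁ C₂ : Carrier
  C₁ = half (half (half 1#))
  C₂ = 9 · 1#

  Rows-cover-area : ∀ {m h n} → 0# < h → 0# < n → m · h ≈ n →
    IsLowerBound (λ c → ∃ λ B → Covers B (Rows m h n) × TotalArea B c) (C₁ * (n * n))
  Rows-cover-area {m} {h} {n} 0<h 0<n mh≈n c (B , covers , total-ub , _) =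
    let K , K≤ = rows-mass m 0<h 0<n λ i i<m x y x∈ y∈ → covers (x , y) (i , i<m , x∈ , y∈)
    in begin
      C₁ * (n * n)                     ≈⟨ solve 3 (λ o t n → o :* t :* t :* t :* (n :* n) := (n :* t) :* (o :* n :* t :* t)) refl 1# t n ⟩
      n * t * (1# * n * t * t)         ≈⟨ *-congˡ (*-congʳ (*-congʳ (*-identityˡ n))) ⟩
      n * t * half (half n)            ≈⟨ *-congʳ (*-congʳ (sym mh≈n)) ⟩
      m · h * t * half (half n)        ≈⟨ *-congʳ (*-congʳ (k·x≈[k·1]*x m h)) ⟩
      m · 1# * h * t * half (half n)   ≈⟨ solve 4 (λ m h t q → m :* h :* t :* q := m :* (h :* t :* q)) refl (m · 1#) h t (half (half n)) ⟩
      m · 1# * (half h * half (half n))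
                                       ≈⟨ sym (k·x≈[k·1]*x m _) ⟩
      m · (half h * half (half n))     ≤⟨ K≤ ⟩
      massUpTo K 0# (m · h) 0# (0# + n) ≤⟨ massUpTo≤area K (·-nonNeg m (<⇒≤ 0<h)) ⟩
      sum {K} (λ i → area (B (toℕ i))) ≤⟨ total-ub _ (K , refl) ⟩
      c                                ∎
    where
    open ≤-Reasoning
    open Cover B
    t = (1# + 1#) ⁻¹

  module _ {n : Carrier} (0<n : 0# < n) where

    -n<0 : - n < 0#
    -n<0 = <-by n 0<n (solve 1 (λ n → n := con (+ 0) :- :- n) refl n)

    enlargedSquare : Box
    enlargedSquare = record
      { left = - n ; right = n + n ; bottom = - n ; top = n + n
      ; left≤right = -n≤2n ; bottom≤top = -n≤2n }
      where
      -n≤2n : - n ≤ n + n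
      -n≤2n = ≤-trans (<⇒≤ -n<0) (0≤x+y (<⇒≤ 0<n) (<⇒≤ 0<n))

    origin : Box
    origin = record
      { left = 0# ; right = 0# ; bottom = 0# ; top = 0# ; left≤right = ≤-refl ; bottom≤top = ≤-refl }

    -- Interiors have to contain the closed square, so the first box reaches beyond it. A cover is
    -- an infinite sequence, so it is padded with boxes of area zero.
    squareCover : ℕ → Box
    squareCover zero    = enlargedSquare
    squareCover (suc _) = origin

    Square-covered : ∀ {S} → S ⊆ Square n → Covers squareCover S
    Square-covered S⊆ p p∈S =
      let (0≤x , x≤n) , (0≤y , y≤n) = S⊆ p∈S
      in 0 , (<-≤-trans -n<0 0≤x , ≤-<-trans x≤n (x<x+y 0<n)) ,
             (<-≤-trans -n<0 0≤y , ≤-<-trans y≤n (x<x+y 0<n))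

    squareCover-area : TotalArea squareCover (C₂ * (n * n))
    squareCover-area = upper , λ b b-ub → ≤-trans (≤-reflexive (trans (sym area≈) (sym (+-identityʳ _)))) (b-ub _ (1 , refl))
      where
      area≈ : area enlargedSquare ≈ C₂ * (n * n)
      area≈ = solve 1 (λ n → (n :+ n :- :- n) :* (n :+ n :- :- n) := con (+ 9) :* (n :* n)) refl n
      degenerate : ∀ k → sum {k} (λ _ → area origin) ≤ 0#
      degenerate zero    = ≤-refl
      degenerate (suc k) = ≤-trans (+-mono-≤ (≤-reflexive (trans (*-congʳ (-‿inverseʳ 0#)) (zeroˡ _))) (degenerate k))
        (≤-reflexive (+-identityˡ 0#))
      0≤area : 0# ≤ C₂ * (n * n)
      0≤area = *-nonNeg (·-nonNeg 9 0≤1) (*-nonNeg (<⇒≤ 0<n) (<⇒≤ 0<n))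
      upper : IsUpperBound (λ a → ∃ λ k → a ≈ sum {k} (λ i → area (squareCover (toℕ i)))) (C₂ * (n * n))
      upper a (zero  , a≈) = ≤-trans (≤-reflexive a≈) 0≤area
      upper a (suc k , a≈) = ≤-trans (≤-reflexive a≈)
        (≤-trans (+-mono-≤ (≤-reflexive area≈) (degenerate k)) (≤-reflexive (+-identityʳ _)))

    -- `S` does double duty: its measure makes the family nonempty, so that the supremum exists, and
    -- bounds it from below. The single cover of the square bounds all the measures from above.
    Opx-between : ∀ {Q S} → Open S → S IsFreeOf Q → S ⊆ Square n →
      IsLowerBound (λ c → ∃ λ B → Covers B S × TotalArea B c) (C₁ * (n * n)) →
      ∃ λ v → Opx n Q v × C₁ * (n * n) ≤ v × v ≤ C₂ * (n * n)
    Opx-between {Q} {S} S-open S-free S⊆ lower =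
      let μ , μ-inf = infimum _ (C₂ * (n * n) , squareCover , Square-covered S⊆ , squareCover-area)
                        (C₁ * (n * n) , lower)
          bounded = λ { _ (_ , _ , _ , S′⊆ , S′-lb , _) →
            S′-lb _ (squareCover , Square-covered S′⊆ , squareCover-area) }
          v , v-ub , v-lub = complete _ (μ , S , S-open , S-free , (λ {p} → S⊆ {p}) , μ-inf) (C₂ * (n * n) , bounded)
      in v , (v-ub , v-lub) ,
         ≤-trans (proj₂ μ-inf _ lower) (v-ub μ (S , S-open , S-free , (λ {p} → S⊆ {p}) , μ-inf)) ,
         v-lub _ bounded

  opx-between : ∀ {P} (D : Box) → (∃ λ p → p ∈ interior D) → interior D ⊆ P → ∀ {n} → 0# < n →
    ∃ λ v → Opx n (RationalPoints P) v × C₁ * (n * n) ≤ v × v ≤ C₂ * (n * n)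
  opx-between D (_ , (l<x , x<r) , (b<y , y<t)) D⊆P {n} 0<n =
    Opx-between 0<n (Rows-open 0<h) (Rows-free D D⊆P 0<n 0<h ρ wide tall mh≈n)
      (Rows-⊆-Square 0<h 0<n mh≈n) (Rows-cover-area 0<h 0<n mh≈n)
    where
    0<width = x<y⇒0<y-x (<-trans l<x x<r)
    0<height = x<y⇒0<y-x (<-trans b<y y<t)
    width-multiple = archimedean-· n 0<width
    height-multiple = archimedean-· n 0<height
    j = proj₁ width-multiple
    k = proj₁ height-multiple
    -- Large enough for both sides of `D`, and positive so that `n` can be divided by ρ².
    ρ = suc (j ℕ.+ k)
    wide = <-≤-trans (proj₂ width-multiple) (·-monoˡ-≤ (<⇒≤ 0<width) (ℕ.m≤n⇒m≤1+n (ℕ.m≤m+n j k)))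
    tall = <-≤-trans (proj₂ height-multiple) (·-monoˡ-≤ (<⇒≤ 0<height) (ℕ.m≤n⇒m≤1+n (ℕ.m≤n+m k j)))
    h = n ÷ (ρ ℕ.* ρ) · 1#
    0<m : 0# < (ρ ℕ.* ρ) · 1#
    0<m = ·-pos (ℕ.pred (ρ ℕ.* ρ)) 0<1
    0<h = ÷-pos 0<m 0<n
    mh≈n : (ρ ℕ.* ρ) · h ≈ n
    mh≈n = trans (k·x≈[k·1]*x (ρ ℕ.* ρ) h) (x*[y÷x]≈y n 0<m)

theorem4p5 : ExcludedMiddle (Level.suc 0ℓ) →
  (ℝ : CompleteOrderedField) →
  let open CompleteOrderedField ℝ
      open Plane ℝ
  in ∃ λ C₂ → 0# < C₂ ×
     ((P : Subset) → Open P → Satisfiable P →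
      ∃ λ C₁ → 0# < C₁ ×
      EventuallyBetween C₁ C₂
        (λ n → Opx n (RationalPoints P)) (λ n → n * n))
theorem4p5 em ℝ = C₂ , ·-pos 8 0<1 , λ P P-open (p , p∈P) →
  let D , p∈D , D⊆P = P-open p p∈P
  -- ρ is chosen after `n`, so the bounds hold for every positive `n` and the threshold can be 0.
  in C₁ , half-pos (half-pos (half-pos 0<1)) , CompleteOrderedField.0# ℝ ,
     λ n 0<n _ → opx-between D (p , p∈D) D⊆P 0<n
  where
  open OrderedField em ℝ
  open OpxBounds em ℝ
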